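{- For all $0<\varepsilon<1/2$ and $d\ge2$, $A^\varepsilon(\mathbb{N},d)=\infty$, i.e. $\lim_{n\to\infty}A^\varepsilon(n,d)=\infty$.
   Context: For a homogeneous polynomial $g\in\mathbb{C}[x_1,\ldots,x_n]_d$, the Waring rank $\mathbf{R}(g)$ is the minimum $r$ such that $g=\ell_1^d+\cdots+\ell_r^d$ for some complex linear forms $\ell_i$ in $x_1,\ldots,x_n$. $A^\varepsilon(n,d)$ is the minimum of $\mathbf{R}(g)$ over all $g\in\mathbb{R}[x_1,\ldots,x_n]_d$ whose support (set of exponents of monomials with nonzero coefficient) is exactly the set of exponents of the multilinear degree-$d$ monomials $x_{i_1}\cdots x_{i_d}$, $1\le i_1<\cdots<i_d\le n$, and whose nonzero coefficients lie in $[1-\varepsilon,1+\varepsilon]$. $A^\varepsilon(\mathbb{N},d):=\lim_{n\to\infty}A^\varepsilon(n,d)$. -}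

module Defs where

open import Algebra.Bundles using (RawRing)
import Algebra.Definitions.RawSemiring as RawSemiringDefs
open import Data.Fin.Base using (Fin; toℕ)
open import Data.Nat.Base as ℕ using (ℕ; zero; suc)
import Data.Nat.Properties as ℕ
open import Data.Product.Base using (∃-syntax; Σ-syntax; _×_; _,_; proj₁; proj₂)
open import Data.Rational.Base as ℚ using (ℚ; 0ℚ; 1ℚ; ½; ∣_∣; Positive; 1/_)
import Data.Rational.Properties as ℚ
open import Data.Rational.Solver using (module +-*-Solver)
open import Data.Vec.Base as Vec using (Vec; []; _∷_)
open import Data.Vec.Relation.Unary.All using (All)
open import Function.Base using (_∘_)
open import Function.Bundles using (_⇔_)
open import Level using (0ℓ; _⊔_)
open import Relation.Binary.PropositionalEquality
  using (_≡_; _≢_; refl; sym; trans; cong; subst; subst₂)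
open import Relation.Nullary.Negation using (¬_)

------------------------------------------------------------------------
-- Real numbers: Cauchy sequences of rationals, up to the usual
-- equivalence.  The Cauchy condition is a Σ-type, so a real number
-- carries a modulus of convergence; the field operations are pointwise.

Eventually : (ℕ → Set) → Set
Eventually P = ∃[ N ] ∀ n → N ℕ.≤ n → P n

IsCauchy : (ℕ → ℚ) → Set
IsCauchy x = ∀ e → 0ℚ ℚ.< e →
  ∃[ N ] ∀ m n → N ℕ.≤ m → N ℕ.≤ n → ∣ x m ℚ.- x n ∣ ℚ.< e

record ℝ : Set where
  constructor mkℝ
  field
    seq    : ℕ → ℚ
    cauchy : IsCauchy seq

open ℝ public

private
  0<½* : ∀ {e} → 0ℚ ℚ.< e → 0ℚ ℚ.< ½ ℚ.* e
  0<½* {e} 0<e = subst (ℚ._< ½ ℚ.* e) (ℚ.*-zeroʳ ½) (ℚ.*-monoʳ-<-pos ½ 0<e)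

  ½+½ : ∀ e → ½ ℚ.* e ℚ.+ ½ ℚ.* e ≡ e
  ½+½ e = trans (sym (ℚ.*-distribʳ-+ e ½ ½)) (ℚ.*-identityˡ e)

  ∣p∣<a∧∣q∣<b⇒∣p+q∣<a+b : ∀ {p q a b} → ∣ p ∣ ℚ.< a → ∣ q ∣ ℚ.< b →
                          ∣ p ℚ.+ q ∣ ℚ.< a ℚ.+ b
  ∣p∣<a∧∣q∣<b⇒∣p+q∣<a+b {p} {q} p<a q<b =
    ℚ.≤-<-trans (ℚ.∣p+q∣≤∣p∣+∣q∣ p q) (ℚ.+-mono-< p<a q<b)

  const-cauchy : ∀ q → IsCauchy (λ _ → q)
  const-cauchy q e 0<e = 0 , λ _ _ _ _ →
    subst (ℚ._< e) (cong ∣_∣ (sym (ℚ.+-inverseʳ q))) 0<e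

  +-cauchy : ∀ x y → IsCauchy x → IsCauchy y → IsCauchy (λ n → x n ℚ.+ y n)
  +-cauchy x y cx cy e 0<e
    with M , hx ← cx (½ ℚ.* e) (0<½* 0<e)
    with N , hy ← cy (½ ℚ.* e) (0<½* 0<e)
    = M ℕ.+ N , λ m n m≥ n≥ →
      subst₂ (λ p q → ∣ p ∣ ℚ.< q)
        (solve 4 (λ a b c d → (a :- b) :+ (c :- d) := (a :+ c) :- (b :+ d))
               refl (x m) (x n) (y m) (y n))
        (½+½ e)
        (∣p∣<a∧∣q∣<b⇒∣p+q∣<a+b
          (hx m n (ℕ.m+n≤o⇒m≤o M m≥) (ℕ.m+n≤o⇒m≤o M n≥))
          (hy m n (ℕ.m+n≤o⇒n≤o M m≥) (ℕ.m+n≤o⇒n≤o M n≥)))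
    where open +-*-Solver

  neg-cauchy : ∀ x → IsCauchy x → IsCauchy (λ n → ℚ.- x n)
  neg-cauchy x cx e 0<e with N , hx ← cx e 0<e
    = N , λ m n m≥ n≥ →
      subst (λ p → ∣ p ∣ ℚ.< e)
        (solve 2 (λ a b → b :- a := :- a :- :- b) refl (x m) (x n))
        (hx n m n≥ m≥)
    where open +-*-Solver

  cauchy⇒bounded : ∀ x → IsCauchy x →
                   ∃[ B ] Positive B × Eventually (λ n → ∣ x n ∣ ℚ.< B)
  cauchy⇒bounded x cx with N , hx ← cx 1ℚ (ℚ.positive⁻¹ 1ℚ)
    = 1ℚ ℚ.+ ∣ x N ∣
    , ℚ.pos+nonNeg⇒pos 1ℚ ∣ x N ∣ {{ℚ.∣-∣-nonNeg (x N)}}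
    , N , λ n n≥ →
      subst (λ p → ∣ p ∣ ℚ.< 1ℚ ℚ.+ ∣ x N ∣)
        (solve 2 (λ a b → (a :- b) :+ b := a) refl (x n) (x N))
        (ℚ.≤-<-trans (ℚ.∣p+q∣≤∣p∣+∣q∣ (x n ℚ.- x N) (x N))
          (ℚ.+-monoˡ-< ∣ x N ∣ (hx n N n≥ ℕ.≤-refl)))
    where open +-*-Solver

  recip : ∀ p {{_ : Positive p}} → ℚ
  recip p = (1/ p) {{ℚ.pos⇒nonZero p}}

  product-bound : ∀ {p q B e} {{_ : Positive B}} →
                  ∣ p ∣ ℚ.< B → ∣ q ∣ ℚ.< recip B ℚ.* e → ∣ p ℚ.* q ∣ ℚ.< e
  product-bound {p} {q} {B} {e} p<B q<e/B =
    subst (ℚ._< e) (sym (ℚ.∣p*q∣≡∣p∣*∣q∣ p q))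
      (ℚ.≤-<-trans
        (ℚ.*-monoʳ-≤-nonNeg ∣ q ∣ {{ℚ.∣-∣-nonNeg q}} (ℚ.<⇒≤ p<B))
        (subst (B ℚ.* ∣ q ∣ ℚ.<_)
          (trans (sym (ℚ.*-assoc B (recip B) e))
            (trans (cong (ℚ._* e) (ℚ.*-inverseʳ B {{ℚ.pos⇒nonZero B}})) (ℚ.*-identityˡ e)))
          (ℚ.*-monoʳ-<-pos B q<e/B)))

  0<1/* : ∀ {B e} {{_ : Positive B}} →
          0ℚ ℚ.< e → 0ℚ ℚ.< recip B ℚ.* e
  0<1/* {B} {e} 0<e = subst (ℚ._< recip B ℚ.* e) (ℚ.*-zeroʳ (recip B))
    (ℚ.*-monoʳ-<-pos (recip B) {{ℚ.1/pos⇒pos B}} 0<e)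

  product-difference : ∀ p p′ q q′ →
    p ℚ.* (q ℚ.- q′) ℚ.+ q′ ℚ.* (p ℚ.- p′) ≡ p ℚ.* q ℚ.- p′ ℚ.* q′
  product-difference = solve 4
    (λ p p′ q q′ → p :* (q :- q′) :+ q′ :* (p :- p′) := p :* q :- p′ :* q′) refl
    where open +-*-Solver

  *-cauchy : ∀ x y → IsCauchy x → IsCauchy y → IsCauchy (λ n → x n ℚ.* y n)
  *-cauchy x y cx cy e 0<e = combine (cauchy⇒bounded x cx) (cauchy⇒bounded y cy)
    where
    combine : ∃[ B ] Positive B × Eventually (λ n → ∣ x n ∣ ℚ.< B) →
              ∃[ C ] Positive C × Eventually (λ n → ∣ y n ∣ ℚ.< C) →
              ∃[ N ] ∀ m n → N ℕ.≤ m → N ℕ.≤ n →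
                ∣ x m ℚ.* y m ℚ.- x n ℚ.* y n ∣ ℚ.< e
    combine (B , B>0 , K , bx) (C , C>0 , L , by) =
      K ℕ.+ L ℕ.+ (proj₁ xMod ℕ.+ proj₁ yMod) , bound
      where
      instance
        B-pos : Positive B
        B-pos = B>0
        C-pos : Positive C
        C-pos = C>0
      xMod = cx (recip C ℚ.* (½ ℚ.* e)) (0<1/* {C} (0<½* 0<e))
      yMod = cy (recip B ℚ.* (½ ℚ.* e)) (0<1/* {B} (0<½* 0<e))
      bound : ∀ m n → K ℕ.+ L ℕ.+ (proj₁ xMod ℕ.+ proj₁ yMod) ℕ.≤ m →
              K ℕ.+ L ℕ.+ (proj₁ xMod ℕ.+ proj₁ yMod) ℕ.≤ n →
              ∣ x m ℚ.* y m ℚ.- x n ℚ.* y n ∣ ℚ.< e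
      bound m n m≥ n≥ =
        subst₂ (λ p q → ∣ p ∣ ℚ.< q)
          (product-difference (x m) (x n) (y m) (y n)) (½+½ e)
          (∣p∣<a∧∣q∣<b⇒∣p+q∣<a+b
            (product-bound {x m} {y m ℚ.- y n} {B} {½ ℚ.* e}
              (bx m (ℕ.m+n≤o⇒m≤o K K+L≤m))
              (proj₂ yMod m n (ℕ.m+n≤o⇒n≤o (proj₁ xMod) M+N≤m)
                              (ℕ.m+n≤o⇒n≤o (proj₁ xMod) M+N≤n)))
            (product-bound {y n} {x m ℚ.- x n} {C} {½ ℚ.* e}
              (by n (ℕ.m+n≤o⇒n≤o K K+L≤n))
              (proj₂ xMod m n (ℕ.m+n≤o⇒m≤o (proj₁ xMod) M+N≤m)
                              (ℕ.m+n≤o⇒m≤o (proj₁ xMod) M+N≤n))))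
        where
        K+L≤m = ℕ.m+n≤o⇒m≤o (K ℕ.+ L) m≥
        K+L≤n = ℕ.m+n≤o⇒m≤o (K ℕ.+ L) n≥
        M+N≤m = ℕ.m+n≤o⇒n≤o (K ℕ.+ L) m≥
        M+N≤n = ℕ.m+n≤o⇒n≤o (K ℕ.+ L) n≥

fromℚ : ℚ → ℝ
fromℚ q = mkℝ (λ _ → q) (const-cauchy q)

0ℝ 1ℝ ½ℝ : ℝ
0ℝ = fromℚ 0ℚ
1ℝ = fromℚ 1ℚ
½ℝ = fromℚ ½

infixl 6 _+ᴿ_ _-ᴿ_
infixl 7 _*ᴿ_
infix  8 -ᴿ_
infix  4 _≈ᴿ_ _<ᴿ_ _≤ᴿ_

_+ᴿ_ _*ᴿ_ : ℝ → ℝ → ℝ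
x +ᴿ y = mkℝ (λ n → seq x n ℚ.+ seq y n) (+-cauchy (seq x) (seq y) (cauchy x) (cauchy y))
x *ᴿ y = mkℝ (λ n → seq x n ℚ.* seq y n) (*-cauchy (seq x) (seq y) (cauchy x) (cauchy y))

-ᴿ_ : ℝ → ℝ
-ᴿ x = mkℝ (λ n → ℚ.- seq x n) (neg-cauchy (seq x) (cauchy x))

_-ᴿ_ : ℝ → ℝ → ℝ
x -ᴿ y = x +ᴿ (-ᴿ y)

_≈ᴿ_ _<ᴿ_ _≤ᴿ_ : ℝ → ℝ → Set
x ≈ᴿ y = ∀ e → 0ℚ ℚ.< e → Eventually (λ n → ∣ seq x n ℚ.- seq y n ∣ ℚ.< e)
x <ᴿ y = ∃[ e ] 0ℚ ℚ.< e × Eventually (λ n → seq x n ℚ.+ e ℚ.< seq y n)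
x ≤ᴿ y = ∀ e → 0ℚ ℚ.< e → Eventually (λ n → seq x n ℚ.< seq y n ℚ.+ e)

ℝ-rawRing : RawRing 0ℓ 0ℓ
ℝ-rawRing = record
  { Carrier = ℝ ; _≈_ = _≈ᴿ_ ; _+_ = _+ᴿ_ ; _*_ = _*ᴿ_ ; -_ = -ᴿ_
  ; 0# = 0ℝ ; 1# = 1ℝ }

------------------------------------------------------------------------
-- Complex numbers

record ℂ : Set where
  constructor _+i_
  field
    re im : ℝ

open ℂ public

ℂ-rawRing : RawRing 0ℓ 0ℓ
ℂ-rawRing = record
  { Carrier = ℂ
  ; _≈_ = λ z w → re z ≈ᴿ re w × im z ≈ᴿ im w
  ; _+_ = λ z w → (re z +ᴿ re w) +i (im z +ᴿ im w)
  ; _*_ = λ z w → (re z *ᴿ re w -ᴿ im z *ᴿ im w) +i (re z *ᴿ im w +ᴿ im z *ᴿ re w)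
  ; -_  = λ z → (-ᴿ re z) +i (-ᴿ im z)
  ; 0#  = 0ℝ +i 0ℝ
  ; 1#  = 1ℝ +i 0ℝ
  }

fromℝ : ℝ → ℂ
fromℝ x = x +i 0ℝ

------------------------------------------------------------------------
-- Homogeneous polynomials

-- (a₁ , … , aₙ) stands for the monomial x₁^a₁ ⋯ xₙ^aₙ.
Exponent : ℕ → Set
Exponent n = Vec ℕ n

module _ {c ℓ} (R : RawRing c ℓ) where
  open RawRing R
  open RawSemiringDefs rawSemiring using (sum)

  -- All families of coefficients, i.e. formal power series; polynomials
  -- are multiplied here and then cut out by `HomPoly` below.
  Coefficients : ℕ → Set c
  Coefficients n = Exponent n → Carrier

  -- (f ∙ g)_α = Σ_{β+γ=α} f_β g_γ, where β and γ are chosen one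
  -- coordinate at a time.
  cauchyProduct : ∀ {n} → Coefficients n → Coefficients n → Coefficients n
  cauchyProduct f g []      = f [] * g []
  cauchyProduct f g (a ∷ α) = sum {suc a} λ i →
    cauchyProduct (f ∘ (toℕ i ∷_)) (g ∘ ((a ℕ.∸ toℕ i) ∷_)) α

  one : ∀ {n} → Coefficients n
  one []          = 1#
  one (zero  ∷ α) = one α
  one (suc _ ∷ α) = 0#

  coefficientsRawRing : ℕ → RawRing c ℓ
  coefficientsRawRing n = record
    { Carrier = Coefficients n
    ; _≈_ = λ f g → ∀ α → f α ≈ g α
    ; _+_ = λ f g α → f α + g α
    ; _*_ = cauchyProduct
    ; -_  = λ f α → - f α
    ; 0#  = λ _ → 0#
    ; 1#  = one
    }

  -- R[x₁, …, xₙ]_d.  The support is automatically finite, since there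
  -- are finitely many exponents of total degree d.
  record HomPoly (n d : ℕ) : Set (c ⊔ ℓ) where
    constructor mkHomPoly
    field
      coeff       : Coefficients n
      homogeneous : ∀ α → Vec.sum α ≢ d → coeff α ≈ 0#

open HomPoly public

complexify : ∀ {n d} → HomPoly ℝ-rawRing n d → HomPoly ℂ-rawRing n d
complexify g = mkHomPoly (fromℝ ∘ coeff g) λ α α≢d →
  homogeneous g α α≢d , λ e 0<e → 0 , λ _ _ → 0<e

------------------------------------------------------------------------
-- Waring rank over ℂ

IsLeast : (ℕ → Set) → ℕ → Set
IsLeast P m = P m × (∀ k → P k → m ℕ.≤ k)

HasWaringDecomposition : ∀ {n d} → HomPoly ℂ-rawRing n d → ℕ → Set
HasWaringDecomposition {n} {d} g r =
  Σ[ ℓ ∈ (Fin r → HomPoly ℂ-rawRing n 1) ] coeff g ≈ sum (λ k → coeff (ℓ k) ^ d)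
  where
  open RawRing (coefficientsRawRing ℂ-rawRing n) using (_≈_; rawSemiring)
  open RawSemiringDefs rawSemiring using (sum; _^_)

IsWaringRank : ∀ {n d} → HomPoly ℂ-rawRing n d → ℕ → Set
IsWaringRank g = IsLeast (HasWaringDecomposition g)

------------------------------------------------------------------------
-- The quantity A^ε(n,d)

-- Exponents of x_{i₁} ⋯ x_{i_d} with i₁ < ⋯ < i_d.
IsMultilinear : ∀ {n} → ℕ → Exponent n → Set
IsMultilinear d α = All (ℕ._≤ 1) α × Vec.sum α ≡ d

InSupport : ∀ {n d} → HomPoly ℝ-rawRing n d → Exponent n → Set
InSupport g α = ¬ (coeff g α ≈ᴿ 0ℝ)

record Admissible (ε : ℝ) {n d : ℕ} (g : HomPoly ℝ-rawRing n d) : Set where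
  field
    support : ∀ α → InSupport g α ⇔ IsMultilinear d α
    lower   : ∀ α → InSupport g α → 1ℝ -ᴿ ε ≤ᴿ coeff g α
    upper   : ∀ α → InSupport g α → coeff g α ≤ᴿ 1ℝ +ᴿ ε

-- `A ε d n a` says A^ε(n,d) = a.  The minimum is given by its graph
-- because a least element of a set of natural numbers cannot be computed
-- from a mere element of it.
A : ℝ → ℕ → ℕ → ℕ → Set
A ε d n = IsLeast λ r →
  ∃[ g ] Admissible ε {n} {d} g × IsWaringRank (complexify g) r

-- lim_{n→∞} f(n) = ∞, for f given by its graph.
TendsToInfinity : (ℕ → ℕ → Set) → Set
TendsToInfinity f = ∀ K → ∃[ N ] ∀ n → N ℕ.≤ n → ∀ a → f n a → K ℕ.≤ a

module Submission where

-- Suppose g = ℓ₁^d + ⋯ + ℓ_r^d with g admissible, and write d = e + 2.  Fix the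
-- variables x₁ , … , x_e and look at the coefficients of g at
-- α = x₁ ⋯ x_e · y_i y_j for the remaining variables y.  By the multinomial
-- theorem, α! times this coefficient is Σ_k d! (a_k)^(x₁ ⋯ x_e y_i) (a_k)^(y_j),
-- where a_k lists the coefficients of ℓ_k; so these numbers form a matrix of
-- complex rank at most r.  It is real with zero diagonal and off-diagonal
-- entries in [1 - ε , 1 + ε].  Expanding real parts and replacing every real
-- number by one sufficiently late rational approximation gives a rational
-- matrix of rank at most 2r with diagonal near 0 and off-diagonal entries in
-- (½ , 2].  The rows of a bounded matrix of rank at most s fall into a number of
-- δ-close classes that depends only on s, δ and the bound, so if the matrix is
-- large, two rows i ≠ j are ¼-close.  But in column j they differ by more than ¼.

open import Defs
open import Algebra.Bundles using (CommutativeRing; RawRing)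
import Algebra.Definitions.RawSemiring as RawSemiringDefs
open import Data.Empty using (⊥)
open import Data.Fin.Base as Fin using (Fin; zero; suc; toℕ; combine)
open import Data.Fin.Properties as Fin using (combine-injective; pigeonhole)
open import Data.Nat.Base as ℕ using (ℕ; zero; suc; _!)
import Data.Nat.Properties as ℕ
open import Data.Nat.Solver using () renaming (module +-*-Solver to ℕ-Solver)
open import Data.Product.Base
open import Data.Rational.Base using (ℚ; 0ℚ; 1ℚ; ½)
import Data.Rational.Properties as ℚ
open import Data.Rational.Solver using () renaming (module +-*-Solver to ℚ-Solver)
open import Data.Sum.Base using (_⊎_; inj₁; inj₂)
open import Data.Vec.Base as Vec using (Vec; []; _∷_; replicate; zipWith)
open import Data.Vec.Properties using (zipWith-identityˡ; zipWith-identityʳ)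
open import Data.Vec.Relation.Unary.All using (All; []; _∷_)
open import Function.Base using (_∘_)
open import Function.Bundles using (Equivalence)
open import Relation.Binary.PropositionalEquality as ≡ using (_≡_; _≢_)
open import Relation.Nullary using (¬_; Dec; yes; no; contradiction)
open import Relation.Nullary.Decidable using (toWitness)

-- Rational matrices of bounded rank

module RationalMatrices where
  open ≡ using (refl; sym; trans; cong; cong₂; subst; subst₂)
  open import Data.Rational.Base
  open import Data.Rational.Properties
  open ℚ-Solver

  -- An upper bound on the rank is an explicit sum of outer products, peeled off one at a time.
  -- Elimination then works on the summands, and no theory of dimension enters.
  data RankAtMost {A B : Set} : ℕ → (A → B → ℚ) → Set where
    none : ∀ {M} → (∀ i j → M i j ≡ 0ℚ) → RankAtMost 0 M
    add  : ∀ {s M M′} (u : A → ℚ) (v : B → ℚ) →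
           (∀ i j → M i j ≡ u i * v j + M′ i j) →
           RankAtMost s M′ → RankAtMost (suc s) M

  -- Row and column operations, pivoting

  module _ {A B : Set} where

    rank-resp : ∀ {s} {M N : A → B → ℚ} → (∀ i j → N i j ≡ M i j) →
                RankAtMost s M → RankAtMost s N
    rank-resp N≡M (none M≡0)    = none λ i j → trans (N≡M i j) (M≡0 i j)
    rank-resp N≡M (add u v e r) = add u v (λ i j → trans (N≡M i j) (e i j)) r

    rank-suc : ∀ {s} {M : A → B → ℚ} → RankAtMost s M → RankAtMost (suc s) M
    rank-suc {M = M} r = add (λ _ → 0ℚ) (λ _ → 0ℚ)
      (λ i j → solve 1 (λ m → m := con 0ℚ :* con 0ℚ :+ m) refl (M i j)) r

    rank-≤ : ∀ {s t} {M : A → B → ℚ} → s ℕ.≤ t → RankAtMost s M → RankAtMost t M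
    rank-≤ {t = zero}  ℕ.z≤n     r             = r
    rank-≤ {t = suc t} ℕ.z≤n     r             = rank-suc (rank-≤ ℕ.z≤n r)
    rank-≤             (ℕ.s≤s s≤t) (add u v e r) = add u v e (rank-≤ s≤t r)

    -- A row operation changes the left factor of each outer product and fixes the right one, so the
    -- number of products stays the same.
    rank-rowOp : ∀ {s} {M : A → B → ℚ} (c : A → ℚ) p → RankAtMost s M →
                 RankAtMost s (λ i j → M i j - c i * M p j)
    rank-rowOp c p (none M≡0) = none λ i j →
      trans (cong₂ (λ x y → x - c i * y) (M≡0 i j) (M≡0 p j))
            (solve 1 (λ c → con 0ℚ :- c :* con 0ℚ := con 0ℚ) refl (c i))
    rank-rowOp c p (add {M′ = M′} u v e r) =
      add (λ i → u i - c i * u p) v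
        (λ i j → trans (cong₂ (λ x y → x - c i * y) (e i j) (e p j))
          (solve 6 (λ ui up vj ci m m′ →
              ui :* vj :+ m :- ci :* (up :* vj :+ m′) :=
              (ui :- ci :* up) :* vj :+ (m :- ci :* m′))
            refl (u i) (u p) (v j) (c i) (M′ i j) (M′ p j)))
        (rank-rowOp c p r)

    rank-colOp : ∀ {s} {M : A → B → ℚ} q (t : B → ℚ) → RankAtMost s M →
                 RankAtMost s (λ i j → M i j - M i q * t j)
    rank-colOp q t (none M≡0) = none λ i j →
      trans (cong₂ (λ x y → x - y * t j) (M≡0 i j) (M≡0 i q))
            (solve 1 (λ c → con 0ℚ :- con 0ℚ :* c := con 0ℚ) refl (t j))
    rank-colOp q t (add {M′ = M′} u v e r) =
      add u (λ j → v j - v q * t j)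
        (λ i j → trans (cong₂ (λ x y → x - y * t j) (e i j) (e i q))
          (solve 6 (λ ui vj vq tj m m′ →
              ui :* vj :+ m :- (ui :* vq :+ m′) :* tj :=
              ui :* (vj :- vq :* tj) :+ (m :- m′ :* tj))
            refl (u i) (v j) (v q) (t j) (M′ i j) (M′ i q)))
        (rank-colOp q t r)

    -- If `u p` is nonzero, the multipliers `u i / u p` cancel the first outer product. Otherwise
    -- that product does not touch row `p`; it is kept, and a later product is cancelled instead.
    -- Some product must do, because `M p q` is nonzero.
    rank-exchange : ∀ {s} {M : A → B → ℚ} p q → M p q ≢ 0ℚ → RankAtMost (suc s) M →
                    ∃[ c ] RankAtMost s (λ i j → M i j - c i * M p j)
    rank-exchange {M = M} p q Mpq≢0 (add {M′ = M′} u v e r) with u p ≟ 0ℚ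
    ... | no up≢0 = (λ i → u i * inv) , rank-resp
          (λ i j → trans (cong₂ (λ x y → x - u i * inv * y) (e i j) (e p j))
            (trans
              (solve 6 (λ ui up k vj m m′ →
                  ui :* vj :+ m :- ui :* k :* (up :* vj :+ m′) :=
                  ui :* vj :* (con 1ℚ :- k :* up) :+ (m :- ui :* k :* m′))
                refl (u i) (u p) inv (v j) (M′ i j) (M′ p j))
              (trans
                (cong (λ z → u i * v j * (1ℚ - z) + (M′ i j - u i * inv * M′ p j))
                  (*-inverseˡ (u p)))
                (solve 3 (λ x y z → x :* y :* (con 1ℚ :- con 1ℚ) :+ z := z)
                  refl (u i) (v j) (M′ i j - u i * inv * M′ p j)))))
          (rank-rowOp (λ i → u i * inv) p r)
      where
      instance _ = ≢-nonZero up≢0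
      inv = 1/ u p
    ... | yes up≡0 = go r
      where
      Mp≡M′p : ∀ j → M p j ≡ M′ p j
      Mp≡M′p j = trans (e p j) (trans (cong (λ z → z * v j + M′ p j) up≡0)
        (solve 2 (λ x y → con 0ℚ :* x :+ y := y) refl (v j) (M′ p j)))
      go : ∀ {s} → RankAtMost s M′ → ∃[ c ] RankAtMost s (λ i j → M i j - c i * M p j)
      go (none M′≡0) = contradiction (trans (Mp≡M′p q) (M′≡0 p q)) Mpq≢0
      go r@(add _ _ _ _) with c , r′ ← rank-exchange p q (λ z → Mpq≢0 (trans (Mp≡M′p q) z)) r =
        c , add u v
          (λ i j → trans (cong₂ (λ x y → x - c i * y) (e i j) (Mp≡M′p j))
            (solve 3 (λ x m n → x :+ m :- n := x :+ (m :- n)) refl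
              (u i * v j) (M′ i j) (c i * M′ p j)))
          r′

    -- The matrix obtained is the Schur complement of the entry `M p q`. `rank-exchange` lowers the
    -- rank with unknown multipliers `c`; the column operation that then clears column `q` cancels
    -- every `c i`.
    rank-pivot : ∀ {s} {M : A → B → ℚ} p q (Mpq≢0 : M p q ≢ 0ℚ) → RankAtMost (suc s) M →
                 let instance _ = ≢-nonZero Mpq≢0 in
                 RankAtMost s (λ i j → M i j - M i q * 1/ M p q * M p j)
    rank-pivot {M = M} p q Mpq≢0 r
      with c , r′ ← rank-exchange p q Mpq≢0 r =
      let instance _ = ≢-nonZero Mpq≢0 in
      rank-resp
        (λ i j → sym (trans
          (solve 6 (λ mij ci mpj miq mpq k →
              mij :- ci :* mpj :- (miq :- ci :* mpq) :* (k :* mpj) :=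
              mij :- miq :* k :* mpj :+ ci :* mpj :* (mpq :* k :- con 1ℚ))
            refl (M i j) (c i) (M p j) (M i q) (M p q) (1/ M p q))
          (trans
            (cong (λ z → M i j - M i q * 1/ M p q * M p j + c i * M p j * (z - 1ℚ))
              (*-inverseʳ (M p q)))
            (solve 3 (λ x a b → x :+ a :* b :* (con 1ℚ :- con 1ℚ) := x) refl
              (M i j - M i q * 1/ M p q * M p j) (c i) (M p j)))))
        (rank-colOp q (λ j → 1/ M p q * M p j) r′)

  -- Largest entries and rounding to intervals

  argmax : ∀ {n} (f : Fin (suc n) → ℚ) → ∃[ i ] ∀ j → f j ≤ f i
  argmax {zero}  f = zero , λ { zero → ≤-refl }
  argmax {suc n} f with i , fi-max ← argmax (λ j → f (suc j)) | ≤-total (f zero) (f (suc i))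
  ... | inj₁ f0≤fi = suc i , λ { zero → f0≤fi ; (suc j) → fi-max j }
  ... | inj₂ fi≤f0 = zero , λ { zero → ≤-refl ; (suc j) → ≤-trans (fi-max j) fi≤f0 }

  -- This is 2^b x, written so that bisection can split off one half by definition.
  doubled : ℕ → ℚ → ℚ
  doubled zero    x = x
  doubled (suc b) x = doubled b x + doubled b x

  -- Halving the tolerance costs exactly one further doubling, so a bound on entries can be restated
  -- relative to the halved tolerance.
  doubled-½ : ∀ b x → doubled (suc b) (½ * x) ≡ doubled b x
  doubled-½ zero    x = trans (sym (*-distribʳ-+ x ½ ½)) (*-identityˡ x)
  doubled-½ (suc b) x = cong (λ z → z + z) (doubled-½ b x)

  ∣-∣≤ : ∀ {p q} → p ≤ q → - q ≤ p → ∣ p ∣ ≤ q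
  ∣-∣≤ {p} {q} p≤q -q≤p with ∣p∣≡p∨∣p∣≡-p p
  ... | inj₁ e = subst (_≤ q) (sym e) p≤q
  ... | inj₂ e = subst₂ _≤_ (sym e) (solve 1 (λ x → :- :- x := x) refl q) (neg-antimono-≤ -q≤p)

  p≤∣p∣ : ∀ p → p ≤ ∣ p ∣
  p≤∣p∣ p with ≤-total 0ℚ p
  ... | inj₁ 0≤p = ≤-reflexive (sym (0≤p⇒∣p∣≡p 0≤p))
  ... | inj₂ p≤0 = ≤-trans p≤0 (0≤∣p∣ p)

  -∣p∣≤p : ∀ p → - ∣ p ∣ ≤ p
  -∣p∣≤p p = subst (- ∣ p ∣ ≤_) (solve 1 (λ x → :- :- x := x) refl p)
    (neg-antimono-≤ (subst (- p ≤_) (∣-p∣≡∣p∣ p) (p≤∣p∣ (- p))))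

  ∣-∣-close : ∀ {lo w x y} → lo ≤ x → x ≤ lo + w → lo ≤ y → y ≤ lo + w → ∣ x - y ∣ ≤ w
  ∣-∣-close {lo} {w} {x} {y} lo≤x x≤ lo≤y y≤ = ∣-∣≤
    (subst (x - y ≤_) (solve 2 (λ l w → l :+ w :- l := w) refl lo w)
      (+-mono-≤ x≤ (neg-antimono-≤ lo≤y)))
    (subst (_≤ x - y) (solve 2 (λ l w → l :- (l :+ w) := :- w) refl lo w)
      (+-mono-≤ lo≤x (neg-antimono-≤ y≤)))

  -- Numbers the 2^t pieces of width `w` of the interval that starts at `lo`, and finds the piece of
  -- `x` by binary search. The result is meaningful only for `x` in that interval.
  bisect : ∀ t → ℚ → ℚ → ℚ → Fin (2 ℕ.^ t)
  bisect zero    lo w x = zero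
  bisect (suc t) lo w x with x ≤? lo + doubled t w
  ... | yes _ = combine {2} zero (bisect t lo w x)
  ... | no  _ = combine {2} (suc zero) (bisect t (lo + doubled t w) w x)

  -- As `combine` is injective, equal numbers agree in every binary digit. Hence `x` and `y` enter
  -- the same half at each stage and end in one interval of width `w`.
  bisect-close : ∀ t lo w x y → lo ≤ x → x ≤ lo + doubled t w → lo ≤ y → y ≤ lo + doubled t w →
                 bisect t lo w x ≡ bisect t lo w y → ∣ x - y ∣ ≤ w
  bisect-close zero lo w x y lo≤x x≤ lo≤y y≤ _ = ∣-∣-close lo≤x x≤ lo≤y y≤
  bisect-close (suc t) lo w x y lo≤x x≤ lo≤y y≤ eq
    with x ≤? lo + doubled t w | y ≤? lo + doubled t w
  ... | yes x≤m | yes y≤m = bisect-close t lo w x y lo≤x x≤m lo≤y y≤m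
          (proj₂ (combine-injective {2} zero (bisect t lo w x) zero (bisect t lo w y) eq))
  ... | no x≰m | no y≰m = bisect-close t _ w x y
          (<⇒≤ (≰⇒> x≰m)) (subst (x ≤_) (sym (+-assoc lo _ _)) x≤)
          (<⇒≤ (≰⇒> y≰m)) (subst (y ≤_) (sym (+-assoc lo _ _)) y≤)
          (proj₂ (combine-injective {2} (suc zero) (bisect t _ w x) (suc zero) (bisect t _ w y) eq))
  ... | yes _ | no _ = contradiction
          (proj₁ (combine-injective {2} zero (bisect t _ w x) (suc zero) (bisect t _ w y) eq)) λ ()
  ... | no _ | yes _ = contradiction
          (proj₁ (combine-injective {2} (suc zero) (bisect t _ w x) zero (bisect t _ w y) eq)) λ ()

  ∣*∣-mono : ∀ {p q a b} → ∣ p ∣ ≤ a → ∣ q ∣ ≤ b → ∣ p * q ∣ ≤ a * b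
  ∣*∣-mono {p} {q} {a} {b} p≤a q≤b = subst (_≤ a * b) (sym (∣p*q∣≡∣p∣*∣q∣ p q))
    (≤-trans (*-monoʳ-≤-nonNeg ∣ q ∣ {{∣-∣-nonNeg q}} p≤a)
             (*-monoˡ-≤-nonNeg a {{nonNegative (≤-trans (0≤∣p∣ p) p≤a)}} q≤b))

  -- The number of classes of rows when the rank is at most s and the entries are
  -- at most 2^b times the prescribed distance.
  codes : ℕ → ℕ → ℕ
  codes zero    b = 1
  codes (suc s) b = 2 ℕ.^ (2 ℕ.+ b) ℕ.* codes s (2 ℕ.+ b)

  -- An arbitrary class, for the zero matrix, where all rows may share one; the arguments of
  -- `bisect` are dummies.
  anyCode : ∀ s b → Fin (codes s b)
  anyCode zero    b = zero
  anyCode (suc s) b = combine (bisect (2 ℕ.+ b) 0ℚ 0ℚ 0ℚ) (anyCode s (2 ℕ.+ b))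

  RowCode : ∀ {m n} → ℕ → ℚ → (Fin m → Fin n → ℚ) → Set
  RowCode {m} N δ M =
    Σ[ f ∈ (Fin m → Fin N) ] ∀ i i′ → f i ≡ f i′ → ∀ j → ∣ M i j - M i′ j ∣ ≤ δ

  zero-close : ∀ {δ p q} → 0ℚ ≤ δ → p ≡ 0ℚ → q ≡ 0ℚ → ∣ p - q ∣ ≤ δ
  zero-close 0≤δ refl refl = 0≤δ

  -- Complete pivoting keeps all multipliers at most 1 in absolute value, so the
  -- entries at most double when the rank drops by one.
  encodeRows : ∀ s b δ → 0ℚ ≤ δ → ∀ {m n} {M : Fin (suc m) → Fin (suc n) → ℚ} →
               RankAtMost s M → (∀ i j → ∣ M i j ∣ ≤ doubled b δ) →
               RowCode (codes s b) δ M
  encodeRows zero b δ 0≤δ (none M≡0) _ =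
    (λ _ → zero) , λ i i′ _ j → zero-close 0≤δ (M≡0 i j) (M≡0 i′ j)
  encodeRows (suc s) b δ 0≤δ {M = M} r M≤ = pivotOn (M p q ≟ 0ℚ)
    where
    B = doubled b δ
    rowMax = λ i → argmax (λ j → ∣ M i j ∣)
    colMax = argmax (λ i → ∣ M i (proj₁ (rowMax i)) ∣)
    p = proj₁ colMax
    q = proj₁ (rowMax p)
    M≤Mpq : ∀ i j → ∣ M i j ∣ ≤ ∣ M p q ∣
    M≤Mpq i j = ≤-trans (proj₂ (rowMax i) j) (proj₂ colMax i)
    pivotOn : _ → RowCode (codes (suc s) b) δ M
    -- The entry of largest modulus vanishes, hence so does the whole matrix.
    pivotOn (yes Mpq≡0) =
      (λ _ → anyCode (suc s) b) , λ i i′ _ j → zero-close 0≤δ (M≡0 i j) (M≡0 i′ j)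
      where
      M≡0 : ∀ i j → M i j ≡ 0ℚ
      M≡0 i j = ∣p∣≡0⇒p≡0 (M i j)
        (≤-antisym (subst (λ z → ∣ M i j ∣ ≤ ∣ z ∣) Mpq≡0 (M≤Mpq i j)) (0≤∣p∣ (M i j)))
    pivotOn (no Mpq≢0) =
      -- A row is classified by its rounded multiplier together with the class of its remainder
      -- after elimination.
      (λ i → combine (code i) (f i)) ,
      λ i i′ eq j → close i i′ (combine-injective (code i) (f i) (code i′) (f i′) eq) j
      where
      instance _ = ≢-nonZero Mpq≢0
      c : Fin _ → ℚ
      c i = M i q * 1/ M p q
      ∣c∣≤1 : ∀ i → ∣ c i ∣ ≤ 1ℚ
      ∣c∣≤1 i = subst (∣ c i ∣ ≤_)
        (trans (sym (∣p*q∣≡∣p∣*∣q∣ (M p q) (1/ M p q))) (cong ∣_∣ (*-inverseʳ (M p q))))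
        (∣*∣-mono (M≤Mpq i q) (≤-refl {∣ 1/ M p q ∣}))
      M′ : Fin _ → Fin _ → ℚ
      M′ i j = M i j - c i * M p j
      cM≤B : ∀ i {x} → ∣ x ∣ ≤ B → ∣ c i * x ∣ ≤ B
      cM≤B i x≤B = subst (∣ c i * _ ∣ ≤_) (*-identityˡ B) (∣*∣-mono (∣c∣≤1 i) x≤B)
      -- One of the two extra doublings pays for the growth under elimination, the other for passing
      -- from `δ` to `½ * δ`.
      M′≤ : ∀ i j → ∣ M′ i j ∣ ≤ doubled (2 ℕ.+ b) (½ * δ)
      M′≤ i j = subst (∣ M′ i j ∣ ≤_) (sym (doubled-½ (suc b) δ))
        (≤-trans (∣p-q∣≤∣p∣+∣q∣ (M i j) (c i * M p j)) (+-mono-≤ (M≤ i j) (cM≤B i (M≤ p j))))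
      rest : RowCode (codes s (2 ℕ.+ b)) (½ * δ) M′
      rest = encodeRows s (2 ℕ.+ b) (½ * δ)
        (subst (_≤ ½ * δ) (*-zeroʳ ½) (*-monoˡ-≤-nonNeg ½ 0≤δ)) (rank-pivot p q Mpq≢0 r) M′≤
      f = proj₁ rest
      0≤B : 0ℚ ≤ B
      0≤B = ≤-trans (0≤∣p∣ (M p q)) (M≤ p q)
      -- The multiplier is scaled by the entry bound `B` before rounding, so that its rounding
      -- error, multiplied by an entry of the pivot row, is at most `½ * δ`.
      y : Fin _ → ℚ
      y i = c i * B
      ∣y∣≤B : ∀ i → ∣ y i ∣ ≤ B
      ∣y∣≤B i = cM≤B i (≤-reflexive (0≤p⇒∣p∣≡p 0≤B))
      code : Fin _ → Fin (2 ℕ.^ (2 ℕ.+ b))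
      code i = bisect (2 ℕ.+ b) (- B) (½ * δ) (y i)
      -B≤y : ∀ i → - B ≤ y i
      -B≤y i = ≤-trans (neg-antimono-≤ (∣y∣≤B i)) (-∣p∣≤p (y i))
      y≤-B+2B : ∀ i → y i ≤ - B + doubled (2 ℕ.+ b) (½ * δ)
      y≤-B+2B i = subst (y i ≤_)
        (trans (solve 1 (λ B → B := :- B :+ (B :+ B)) refl B)
               (cong (- B +_) (sym (doubled-½ (suc b) δ))))
        (≤-trans (p≤∣p∣ (y i)) (∣y∣≤B i))
      close : ∀ i i′ → code i ≡ code i′ × f i ≡ f i′ → ∀ j → ∣ M i j - M i′ j ∣ ≤ δ
      close i i′ (eq , eq′) j = subst₂ _≤_
        (cong ∣_∣ (solve 5 (λ m m′ ci ci′ x →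
            (ci :- ci′) :* x :+ (m :- ci :* x :- (m′ :- ci′ :* x)) := m :- m′)
          refl (M i j) (M i′ j) (c i) (c i′) (M p j)))
        (doubled-½ 0 δ)
        (≤-trans (∣p+q∣≤∣p∣+∣q∣ ((c i - c i′) * M p j) (M′ i j - M′ i′ j))
          (+-mono-≤
            (≤-trans
              (∣*∣-mono (≤-refl {∣ c i - c i′ ∣}) (M≤ p j))
              (subst (_≤ ½ * δ)
                (trans (cong ∣_∣ (solve 3 (λ a b B → a :* B :- b :* B := (a :- b) :* B) refl (c i) (c i′) B))
                  (trans (∣p*q∣≡∣p∣*∣q∣ (c i - c i′) B)
                    (cong (∣ c i - c i′ ∣ *_) (0≤p⇒∣p∣≡p 0≤B))))
                (bisect-close (2 ℕ.+ b) (- B) (½ * δ) (y i) (y i′)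
                  (-B≤y i) (y≤-B+2B i) (-B≤y i′) (y≤-B+2B i′) eq)))
            (proj₂ rest i i′ eq′ j)))

  ¼ : ℚ
  ¼ = ½ * ½

  -- By the pigeonhole principle two rows `i` and `j` are ¼-close. In column `j` the second has its
  -- diagonal entry, of modulus below ¼, which forces `M i j` below ½.
  no-hollow : ∀ s {n} (M : Fin n → Fin n → ℚ) → codes s 3 ℕ.< n → RankAtMost s M →
              (∀ i → ∣ M i i ∣ < ¼) → (∀ i j → i ≢ j → ½ < M i j) →
              (∀ i j → i ≢ j → ∣ M i j ∣ ≤ 1ℚ + 1ℚ) → ⊥
  no-hollow s {suc n} M codes<n r diag lower upper = contradict (pigeonhole codes<n (proj₁ enc))
    where
    -- The parameter 3 of `codes` comes from 2 = 8 · ¼.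
    bound : ∀ i j → ∣ M i j ∣ ≤ doubled 3 ¼
    bound i j with i Fin.≟ j
    ... | yes refl = ≤-trans (<⇒≤ (diag i)) (toWitness {a? = ¼ ≤? doubled 3 ¼} _)
    ... | no i≢j = upper i j i≢j
    enc = encodeRows s 3 ¼ (nonNegative⁻¹ ¼) r bound
    contradict : ∃₂ (λ i j → i Fin.< j × proj₁ enc i ≡ proj₁ enc j) → ⊥
    contradict (i , j , i<j , eq) = <-irrefl refl
      (<-trans (lower i j (Fin.<⇒≢ i<j))
        (subst (_< ½) (solve 2 (λ x y → x :- y :+ y := x) refl (M i j) (M j j))
          (≤-<-trans (p≤∣p∣ _)
            (≤-<-trans (∣p+q∣≤∣p∣+∣q∣ (M i j - M j j) (M j j))
              (+-mono-≤-< (proj₂ enc i j eq j) (diag j))))))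

-- Powers of linear forms

-- binom k d is the binomial coefficient (k + d)! / (k! d!).
binom : ℕ → ℕ → ℕ
binom zero    d       = 1
binom (suc k) zero    = 1
binom (suc k) (suc d) = binom (suc k) d ℕ.+ binom k (suc d)

-- Pascal's rule multiplied through by the factorials, which avoids division.
binom*!*! : ∀ k d → binom k d ℕ.* (k ! ℕ.* d !) ≡ (k ℕ.+ d) !
binom*!*! zero    d = ≡.trans (ℕ.*-identityˡ _) (ℕ.*-identityˡ _)
binom*!*! (suc k) zero = ≡.trans (ℕ.*-identityˡ _)
  (≡.trans (ℕ.*-identityʳ _) (≡.cong (λ m → suc m !) (≡.sym (ℕ.+-identityʳ k))))
binom*!*! (suc k) (suc d) = begin
  (b₁ ℕ.+ b₂) ℕ.* (suc k ! ℕ.* suc d !)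
    ≡⟨ solve 6 (λ b₁ b₂ k k! d d! →
        (b₁ :+ b₂) :* ((con 1 :+ k) :* k! :* ((con 1 :+ d) :* d!)) :=
        (con 1 :+ d) :* (b₁ :* ((con 1 :+ k) :* k! :* d!)) :+
        (con 1 :+ k) :* (b₂ :* (k! :* ((con 1 :+ d) :* d!))))
      ≡.refl b₁ b₂ k (k !) d (d !) ⟩
  suc d ℕ.* (b₁ ℕ.* (suc k ! ℕ.* d !)) ℕ.+ suc k ℕ.* (b₂ ℕ.* (k ! ℕ.* suc d !))
    ≡⟨ ≡.cong₂ (λ x y → suc d ℕ.* x ℕ.+ suc k ℕ.* y) (binom*!*! (suc k) d) (binom*!*! k (suc d)) ⟩
  suc d ℕ.* (suc k ℕ.+ d) ! ℕ.+ suc k ℕ.* (k ℕ.+ suc d) !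
    ≡⟨ ≡.cong (λ m → suc d ℕ.* m ! ℕ.+ suc k ℕ.* (k ℕ.+ suc d) !) (≡.sym (ℕ.+-suc k d)) ⟩
  suc d ℕ.* (k ℕ.+ suc d) ! ℕ.+ suc k ℕ.* (k ℕ.+ suc d) !
    ≡⟨ solve 3 (λ k d m → (con 1 :+ d) :* m :+ (con 1 :+ k) :* m :=
                           (con 1 :+ (k :+ (con 1 :+ d))) :* m) ≡.refl k d ((k ℕ.+ suc d) !) ⟩
  (suc k ℕ.+ suc d) ! ∎
  where
  open ≡.≡-Reasoning
  open ℕ-Solver
  b₁ = binom (suc k) d
  b₂ = binom k (suc d)

-- In multi-index notation these are α! and |α|!/α!, the latter built as a product of binomial
-- coefficients.
factorials multinomial : ∀ {n} → Exponent n → ℕ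
factorials []      = 1
factorials (k ∷ α) = k ! ℕ.* factorials α
multinomial []      = 1
multinomial (k ∷ α) = binom k (Vec.sum α) ℕ.* multinomial α

factorials*multinomial : ∀ {n} (α : Exponent n) → factorials α ℕ.* multinomial α ≡ Vec.sum α !
factorials*multinomial []      = ≡.refl
factorials*multinomial (k ∷ α) = begin
  k ! ℕ.* factorials α ℕ.* (binom k (Vec.sum α) ℕ.* multinomial α)
    ≡⟨ solve 4 (λ a b c d → a :* b :* (c :* d) := c :* (a :* (b :* d))) ≡.refl
        (k !) (factorials α) (binom k (Vec.sum α)) (multinomial α) ⟩
  binom k (Vec.sum α) ℕ.* (k ! ℕ.* (factorials α ℕ.* multinomial α))
    ≡⟨ ≡.cong (λ m → binom k (Vec.sum α) ℕ.* (k ! ℕ.* m)) (factorials*multinomial α) ⟩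
  binom k (Vec.sum α) ℕ.* (k ! ℕ.* Vec.sum α !)
    ≡⟨ binom*!*! k (Vec.sum α) ⟩
  (k ℕ.+ Vec.sum α) ! ∎
  where
  open ≡.≡-Reasoning
  open ℕ-Solver

factorials-multilinear : ∀ {n} {α : Exponent n} → All (ℕ._≤ 1) α → factorials α ≡ 1
factorials-multilinear [] = ≡.refl
factorials-multilinear (ℕ.z≤n ∷ α≤1)       = ≡.trans (ℕ.+-identityʳ _) (factorials-multilinear α≤1)
factorials-multilinear (ℕ.s≤s ℕ.z≤n ∷ α≤1) = ≡.trans (ℕ.+-identityʳ _) (factorials-multilinear α≤1)

module LinearPowers {c ℓ} (R : CommutativeRing c ℓ) where
  open CommutativeRing R hiding (zero)
  open import Algebra.Properties.Semiring.Sum semiring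
    using (sum; sum-cong-≋; sum-replicate-zero; *-distribˡ-sum)
  open import Algebra.Properties.Semiring.Mult semiring
    using (×-congʳ; ×-congˡ; ×-homo-1; ×-homo-+; ×-assocˡ; ×-comm-*; ×-assoc-*)
    renaming (_×_ to infixr 8 _·_)
  open import Algebra.Properties.CommutativeMonoid.Mult +-commutativeMonoid using (×-distrib-+)
  open import Algebra.Properties.Semiring.Exp semiring using (_^_; ^-homo-*)
  open import Algebra.Properties.CommutativeSemigroup *-commutativeSemigroup
    using (x∙yz≈y∙xz; interchange)
  open import Relation.Binary.Reasoning.Setoid setoid
  import Algebra.Definitions.RawSemiring as RawSemiringDefs

  private
    Coeffs = Coefficients rawRing

  infixl 7 _⊛_
  _⊛_ : ∀ {n} → Coeffs n → Coeffs n → Coeffs n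
  _⊛_ = cauchyProduct rawRing

  pow : ∀ {n} → Coeffs n → ℕ → Coeffs n
  pow {n} = RawSemiringDefs._^_ (RawRing.rawSemiring (coefficientsRawRing rawRing n))

  coeffSum : ∀ {n r} → (Fin r → Coeffs n) → Coeffs n
  coeffSum {n} = RawSemiringDefs.sum (RawRing.rawSemiring (coefficientsRawRing rawRing n))

  -- Products of coefficient families

  infix 4 _≋_
  _≋_ : ∀ {n} → Coeffs n → Coeffs n → Set ℓ
  f ≋ g = ∀ α → f α ≈ g α

  sum-zero : ∀ {n} {t : Fin n → Carrier} → (∀ i → t i ≈ 0#) → sum t ≈ 0#
  sum-zero {n} t≈0 = trans (sum-cong-≋ t≈0) (sum-replicate-zero n)

  ⊛-cong : ∀ {n} {f f′ g g′ : Coeffs n} → f ≋ f′ → g ≋ g′ → f ⊛ g ≋ f′ ⊛ g′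
  ⊛-cong f≋f′ g≋g′ []      = *-cong (f≋f′ []) (g≋g′ [])
  ⊛-cong f≋f′ g≋g′ (a ∷ α) = sum-cong-≋ {suc a} λ i →
    ⊛-cong (λ β → f≋f′ (toℕ i ∷ β)) (λ β → g≋g′ (a ℕ.∸ toℕ i ∷ β)) α

  ⊛-zeroˡ : ∀ {n} {f g : Coeffs n} → (∀ α → f α ≈ 0#) → ∀ α → (f ⊛ g) α ≈ 0#
  ⊛-zeroˡ f≈0 []      = trans (*-congʳ (f≈0 [])) (zeroˡ _)
  ⊛-zeroˡ {g = g} f≈0 (a ∷ α) = sum-zero {suc a} λ i →
    ⊛-zeroˡ {g = g ∘ (a ℕ.∸ toℕ i ∷_)} (λ β → f≈0 (toℕ i ∷ β)) α

  ⊛-zeroʳ : ∀ {n} {f g : Coeffs n} → (∀ α → g α ≈ 0#) → ∀ α → (f ⊛ g) α ≈ 0#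
  ⊛-zeroʳ g≈0 []      = trans (*-congˡ (g≈0 [])) (zeroʳ _)
  ⊛-zeroʳ {f = f} g≈0 (a ∷ α) = sum-zero {suc a} λ i →
    ⊛-zeroʳ {f = f ∘ (toℕ i ∷_)} (λ β → g≈0 (a ℕ.∸ toℕ i ∷ β)) α

  ⊛-scaleʳ : ∀ {n} x (f g : Coeffs n) α → (f ⊛ (λ β → x * g β)) α ≈ x * (f ⊛ g) α
  ⊛-scaleʳ x f g []      = x∙yz≈y∙xz _ _ _
  ⊛-scaleʳ x f g (a ∷ α) = trans
    (sum-cong-≋ {suc a} λ i → ⊛-scaleʳ x (f ∘ (toℕ i ∷_)) (g ∘ (a ℕ.∸ toℕ i ∷_)) α)
    (sym (*-distribˡ-sum {suc a} x
      (λ i → ((f ∘ (toℕ i ∷_)) ⊛ (g ∘ (a ℕ.∸ toℕ i ∷_))) α)))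

  -- Multiplication by a constant polynomial. Being constant is only asked up to `_≈_`, since this
  -- is how the slices of a linear form are constant.
  ⊛-constˡ : ∀ {n} {x} {f g : Coeffs n} → (∀ α → f α ≈ x * one rawRing α) →
             ∀ α → (f ⊛ g) α ≈ x * g α
  ⊛-constˡ f≈x []      = *-congʳ (trans (f≈x []) (*-identityʳ _))
  ⊛-constˡ f≈x (a ∷ α) = trans
    (+-cong (⊛-constˡ (λ β → f≈x (0 ∷ β)) α)
      (sum-zero {a} λ i → ⊛-zeroˡ (λ β → trans (f≈x (ℕ.suc (toℕ i) ∷ β)) (zeroʳ _)) α))
    (+-identityʳ _)

  one-cases : ∀ {n} (α : Exponent n) →
              α ≡ replicate n 0 × one rawRing α ≡ 1# ⊎ Vec.sum α ≢ 0 × one rawRing α ≡ 0#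
  one-cases []          = inj₁ (≡.refl , ≡.refl)
  one-cases (zero  ∷ α) with one-cases α
  ... | inj₁ (≡.refl , e) = inj₁ (≡.refl , e)
  ... | inj₂ r            = inj₂ r
  one-cases (suc _ ∷ α) = inj₂ ((λ ()) , ≡.refl)

  -- Linear forms and the multinomial theorem

  Linear : ∀ {n} → Coeffs n → Set ℓ
  Linear f = ∀ α → Vec.sum α ≢ 1 → f α ≈ 0#

  lead : ∀ {n} → Coeffs (suc n) → Carrier
  lead {n} f = f (1 ∷ replicate n 0)

  tail : ∀ {n} → Coeffs (suc n) → Coeffs n
  tail f α = f (0 ∷ α)

  -- The value a^α of the monomial with exponent `α` at the vector a of coefficients of the linear
  -- form `f`.
  monomial : ∀ {n} → Coeffs n → Exponent n → Carrier
  monomial f []      = 1#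
  monomial f (k ∷ α) = lead f ^ k * monomial (tail f) α

  monomial-homo : ∀ {n} (f : Coeffs n) α β →
                  monomial f (zipWith ℕ._+_ α β) ≈ monomial f α * monomial f β
  monomial-homo f []      []      = sym (*-identityʳ _)
  monomial-homo f (k ∷ α) (l ∷ β) = trans
    (*-cong (^-homo-* (lead f) k l) (monomial-homo (tail f) α β))
    (interchange _ _ _ _)

  module _ {n} {f : Coeffs (suc n)} (lin : Linear f) where

    lead-one : ∀ α → f (1 ∷ α) ≈ lead f * one rawRing α
    lead-one α with one-cases α
    ... | inj₁ (≡.refl , e) = sym (trans (*-congˡ (reflexive e)) (*-identityʳ _))
    ... | inj₂ (α≢0 , e) = trans (lin (1 ∷ α) (α≢0 ∘ ℕ.suc-injective))
                                 (sym (trans (*-congˡ (reflexive e)) (zeroʳ _)))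

    ⊛-head-zero : ∀ h α → (f ⊛ h) (0 ∷ α) ≈ (tail f ⊛ tail h) α
    ⊛-head-zero h α = +-identityʳ _

    -- A linear form is `lead f` times x₁ plus `tail f`, so only its slices of x₁-degree 0 and 1
    -- contribute to a product.
    ⊛-head-suc : ∀ h k α → (f ⊛ h) (suc k ∷ α) ≈
                 (tail f ⊛ (h ∘ (suc k ∷_))) α + lead f * h (k ∷ α)
    ⊛-head-suc h k α = +-congˡ (trans
      (+-cong (⊛-constˡ lead-one α)
        (sum-zero {k} λ i → ⊛-zeroˡ (λ β → lin (suc (suc (toℕ i)) ∷ β) λ ()) α))
      (+-identityʳ _))

    -- The power f^m has degree at most `m` in x₁. This removes the surplus term of `pow-head` at
    -- `d` = 0.
    pow-vanish : ∀ m k → m ℕ.< k → ∀ α → pow f m (k ∷ α) ≈ 0#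
    pow-vanish zero    (suc k) _ α = refl
    pow-vanish (suc m) (suc k) m<k α = begin
      pow f (suc m) (suc k ∷ α)
        ≈⟨ ⊛-head-suc (pow f m) k α ⟩
      (tail f ⊛ (pow f m ∘ (suc k ∷_))) α + lead f * pow f m (k ∷ α)
        ≈⟨ +-cong (⊛-zeroʳ (pow-vanish m (suc k) (ℕ.<-trans (ℕ.n<1+n m) m<k)) α)
                  (trans (*-congˡ (pow-vanish m k (ℕ.s<s⁻¹ m<k) α)) (zeroʳ _)) ⟩
      0# + 0#
        ≈⟨ +-identityʳ _ ⟩
      0# ∎

    -- The binomial theorem for (lead f · x₁ + tail f)^(k+d), read off at x₁^k. Multiplying by one
    -- more factor `f` reproduces Pascal's recursion for `binom`.
    pow-head : ∀ k d α → pow f (k ℕ.+ d) (k ∷ α) ≈ binom k d · lead f ^ k * pow (tail f) d α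
    pow-head zero    zero    α = sym (trans (*-congʳ (+-identityʳ _)) (*-identityˡ _))
    pow-head zero    (suc d) α = trans (⊛-head-zero (pow f d) α) (trans
      (⊛-cong (λ _ → refl) (λ β → trans (pow-head zero d β)
        (trans (*-congʳ (+-identityʳ _)) (*-identityˡ _))) α)
      (sym (trans (*-congʳ (+-identityʳ _)) (*-identityˡ _))))
    pow-head (suc k) zero    α = begin
      pow f (suc k ℕ.+ 0) (suc k ∷ α)
        ≈⟨ ⊛-head-suc (pow f (k ℕ.+ 0)) k α ⟩
      (tail f ⊛ (pow f (k ℕ.+ 0) ∘ (suc k ∷_))) α + lead f * pow f (k ℕ.+ 0) (k ∷ α)
        ≈⟨ +-cong
            (⊛-zeroʳ (pow-vanish (k ℕ.+ 0) (suc k) (ℕ.s≤s (ℕ.≤-reflexive (ℕ.+-identityʳ k)))) α)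
            (*-congˡ (pow-head k 0 α)) ⟩
      0# + lead f * (binom k 0 · lead f ^ k * one rawRing α)
        ≈⟨ +-identityˡ _ ⟩
      lead f * (binom k 0 · lead f ^ k * one rawRing α)
        ≈⟨ *-assoc _ _ _ ⟨
      lead f * (binom k 0 · lead f ^ k) * one rawRing α
        ≈⟨ *-congʳ (trans (×-comm-* (binom k 0) _ _) (×-congˡ (binom-zeroʳ k))) ⟩
      1 · lead f ^ suc k * one rawRing α ∎
      where
      binom-zeroʳ : ∀ k → binom k 0 ≡ 1
      binom-zeroʳ zero    = ≡.refl
      binom-zeroʳ (suc k) = ≡.refl
    pow-head (suc k) (suc d) α = begin
      pow f (suc k ℕ.+ suc d) (suc k ∷ α)
        ≈⟨ ⊛-head-suc (pow f (k ℕ.+ suc d)) k α ⟩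
      (tail f ⊛ (pow f (k ℕ.+ suc d) ∘ (suc k ∷_))) α + lead f * pow f (k ℕ.+ suc d) (k ∷ α)
        ≈⟨ +-cong
            (⊛-cong (λ _ → refl) (λ β → trans
              (reflexive (≡.cong (λ m → pow f m (suc k ∷ β)) (ℕ.+-suc k d)))
              (pow-head (suc k) d β)) α)
            (*-congˡ (pow-head k (suc d) α)) ⟩
      (tail f ⊛ (λ β → b₁ · lead f ^ suc k * pow (tail f) d β)) α +
      lead f * (b₂ · lead f ^ k * pow (tail f) (suc d) α)
        ≈⟨ +-cong (⊛-scaleʳ _ (tail f) (pow (tail f) d) α)
            (trans (sym (*-assoc _ _ _)) (*-congʳ (×-comm-* b₂ _ _))) ⟩
      b₁ · lead f ^ suc k * pow (tail f) (suc d) α +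
      b₂ · lead f ^ suc k * pow (tail f) (suc d) α
        ≈⟨ distribʳ _ _ _ ⟨
      (b₁ · lead f ^ suc k + b₂ · lead f ^ suc k) * pow (tail f) (suc d) α
        ≈⟨ *-congʳ (×-homo-+ _ b₁ b₂) ⟨
      (b₁ ℕ.+ b₂) · lead f ^ suc k * pow (tail f) (suc d) α ∎
      where
      b₁ = binom (suc k) d
      b₂ = binom k (suc d)

  -- `pow-head` splits off one variable at a time, and the binomial factors accumulate to the
  -- multinomial coefficient.
  multinomial-theorem : ∀ {n} {f : Coeffs n} → Linear f → ∀ α →
                        pow f (Vec.sum α) α ≈ multinomial α · monomial f α
  multinomial-theorem lin [] = sym (+-identityʳ _)
  multinomial-theorem {f = f} lin (k ∷ α) = begin
    pow f (k ℕ.+ Vec.sum α) (k ∷ α)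
      ≈⟨ pow-head lin k (Vec.sum α) α ⟩
    b · lead f ^ k * pow (tail f) (Vec.sum α) α
      ≈⟨ *-congˡ (multinomial-theorem (λ β → lin (0 ∷ β)) α) ⟩
    b · lead f ^ k * (multinomial α · monomial (tail f) α)
      ≈⟨ ×-assoc-* b _ _ ⟩
    b · (lead f ^ k * (multinomial α · monomial (tail f) α))
      ≈⟨ ×-congʳ b (×-comm-* (multinomial α) _ _) ⟩
    b · (multinomial α · monomial f (k ∷ α))
      ≈⟨ ×-assocˡ _ b (multinomial α) ⟩
    (b ℕ.* multinomial α) · monomial f (k ∷ α) ∎
    where b = binom k (Vec.sum α)

  -- The factor α! turns the multinomial coefficient into d!, which is the same for all exponents;
  -- only then do the entries of the flattening factor into rows and columns.
  factorials·pow : ∀ {n} {f : Coeffs n} → Linear f → ∀ d α → Vec.sum α ≡ d →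
                   factorials α · pow f d α ≈ (d !) · monomial f α
  factorials·pow {f = f} lin d α ≡.refl = begin
    factorials α · pow f d α
      ≈⟨ ×-congʳ (factorials α) (multinomial-theorem lin α) ⟩
    factorials α · (multinomial α · monomial f α)
      ≈⟨ ×-assocˡ _ (factorials α) (multinomial α) ⟩
    (factorials α ℕ.* multinomial α) · monomial f α
      ≈⟨ ×-congˡ (factorials*multinomial α) ⟩
    (d !) · monomial f α ∎

  ·-zeroʳ : ∀ m → m · 0# ≈ 0#
  ·-zeroʳ m = trans (×-congʳ m (sym (zeroˡ 0#))) (trans (sym (×-assoc-* m 0# 0#)) (zeroʳ _))

  factorials·sum-pow : ∀ {n r} {f : Fin r → Coeffs n} → (∀ k → Linear (f k)) →
    ∀ d α → Vec.sum α ≡ d →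
    factorials α · coeffSum (λ k → pow (f k) d) α ≈ sum (λ k → (d !) · monomial (f k) α)
  factorials·sum-pow {r = zero}  lin d α _ = ·-zeroʳ (factorials α)
  factorials·sum-pow {r = suc r} lin d α e = trans
    (×-distrib-+ _ _ (factorials α))
    (+-cong (factorials·pow (lin zero) d α e) (factorials·sum-pow (λ k → lin (suc k)) d α e))

  -- The flattening of a sum of powers

  module _ {n r d} {f : Fin r → Coeffs n} (lin : ∀ k → Linear (f k))
           {g : Coeffs n} (g≋∑f^d : g ≋ coeffSum (λ k → pow (f k) d)) where

    -- Each summand is a function of `β` times a function of `γ`, so the matrix is visibly a sum of
    -- `r` outer products.
    flattening : Exponent n → Exponent n → Carrier
    flattening β γ = sum λ k → (d !) · monomial (f k) β * monomial (f k) γ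

    factorials·coeff : ∀ β γ → Vec.sum (zipWith ℕ._+_ β γ) ≡ d →
      factorials (zipWith ℕ._+_ β γ) · g (zipWith ℕ._+_ β γ) ≈ flattening β γ
    factorials·coeff β γ sum≡d = begin
      factorials α · g α
        ≈⟨ ×-congʳ (factorials α) (g≋∑f^d α) ⟩
      factorials α · coeffSum (λ k → pow (f k) d) α
        ≈⟨ factorials·sum-pow lin d α sum≡d ⟩
      sum (λ k → (d !) · monomial (f k) α)
        ≈⟨ sum-cong-≋ (λ k → trans (×-congʳ (d !) (monomial-homo (f k) β γ))
                                   (sym (×-assoc-* (d !) _ _))) ⟩
      flattening β γ ∎
      where α = zipWith ℕ._+_ β γ

    flattening-multilinear : ∀ β γ → IsMultilinear d (zipWith ℕ._+_ β γ) →
                             flattening β γ ≈ g (zipWith ℕ._+_ β γ)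
    flattening-multilinear β γ (α≤1 , sum≡d) = trans (sym (factorials·coeff β γ sum≡d))
      (trans (×-congˡ (factorials-multilinear α≤1)) (×-homo-1 _))

    -- The factor α! preserves zero. This serves the diagonal, where α! is 2.
    flattening-zero : ∀ β γ → Vec.sum (zipWith ℕ._+_ β γ) ≡ d →
                      g (zipWith ℕ._+_ β γ) ≈ 0# → flattening β γ ≈ 0#
    flattening-zero β γ sum≡d g≈0 = trans (sym (factorials·coeff β γ sum≡d))
      (trans (×-congʳ (factorials (zipWith ℕ._+_ β γ)) g≈0) (·-zeroʳ (factorials (zipWith ℕ._+_ β γ))))

-- Real and complex numbers

module RealAnalysis where
  open ≡ using (refl; sym; trans; cong; cong₂; subst; subst₂)
  open import Data.Rational.Base
  open import Data.Rational.Properties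
  open ℚ-Solver

  open RationalMatrices using (p≤∣p∣; -∣p∣≤p; ∣-∣≤)

  0<½* : ∀ {e} → 0ℚ < e → 0ℚ < ½ * e
  0<½* {e} 0<e = subst (_< ½ * e) (*-zeroʳ ½) (*-monoʳ-<-pos ½ 0<e)

  ½*+½* : ∀ e → ½ * e + ½ * e ≡ e
  ½*+½* e = trans (sym (*-distribʳ-+ e ½ ½)) (*-identityˡ e)

  -- Eventual properties and null sequences

  eventually-× : ∀ {P Q} → Eventually P → Eventually Q → Eventually (λ n → P n × Q n)
  eventually-× (M , p) (N , q) = M ℕ.+ N , λ n n≥ →
    p n (ℕ.m+n≤o⇒m≤o M n≥) , q n (ℕ.m+n≤o⇒n≤o M n≥)

  eventually-map : ∀ {P Q : ℕ → Set} → (∀ {n} → P n → Q n) → Eventually P → Eventually Q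
  eventually-map f (N , p) = N , λ n n≥ → f (p n n≥)

  -- Provides a single late index at which finitely many conditions, here those on all matrix
  -- entries, hold together.
  eventually-Fin : ∀ {k} {P : Fin k → ℕ → Set} → (∀ i → Eventually (P i)) →
                   Eventually (λ n → ∀ i → P i n)
  eventually-Fin {zero}  h = 0 , λ _ _ ()
  eventually-Fin {suc k} h = eventually-map
    (λ { (p , q) → λ { zero → p ; (suc i) → q i } })
    (eventually-× (h zero) (eventually-Fin (λ i → h (suc i))))

  -- `x ≈ᴿ y` unfolds to `Null` of the difference sequence, so the congruences of the real
  -- operations reduce to closure properties of null sequences.
  Null : (ℕ → ℚ) → Set
  Null z = ∀ e → 0ℚ < e → Eventually (λ n → ∣ z n ∣ < e)

  null-resp : ∀ {y z} → (∀ n → y n ≡ z n) → Null y → Null z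
  null-resp y≡z null e 0<e = eventually-map (λ {n} → subst (λ p → ∣ p ∣ < e) (y≡z n)) (null e 0<e)

  null-zero : ∀ {z} → (∀ n → z n ≡ 0ℚ) → Null z
  null-zero z≡0 = null-resp (λ n → sym (z≡0 n)) λ e 0<e → 0 , λ _ _ → 0<e

  null-neg : ∀ {z} → Null z → Null (λ n → - z n)
  null-neg {z} null e 0<e =
    eventually-map (λ {n} → subst (_< e) (sym (∣-p∣≡∣p∣ (z n)))) (null e 0<e)

  null-+ : ∀ {y z} → Null y → Null z → Null (λ n → y n + z n)
  null-+ {y} {z} null-y null-z e 0<e = eventually-map
    (λ {n} (p , q) → ≤-<-trans (∣p+q∣≤∣p∣+∣q∣ (y n) (z n))
      (subst (_ <_) (½*+½* e) (+-mono-< p q)))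
    (eventually-× (null-y (½ * e) (0<½* 0<e)) (null-z (½ * e) (0<½* 0<e)))

  null-* : ∀ {x z} → IsCauchy x → Null z → Null (λ n → x n * z n)
  null-* {x} {z} cauchy-x null-z e 0<e with cauchy-x 1ℚ (positive⁻¹ 1ℚ)
  ... | N , close = eventually-map small
          (eventually-× (N , λ n n≥ → close n N n≥ ℕ.≤-refl) (null-z (1/ B * e) 0<e/B))
    where
    B = 1ℚ + ∣ x N ∣
    instance
      B-pos : Positive B
      B-pos = pos+nonNeg⇒pos 1ℚ ∣ x N ∣ {{∣-∣-nonNeg (x N)}}
      B-nonZero : NonZero B
      B-nonZero = pos⇒nonZero B
    0<e/B : 0ℚ < 1/ B * e
    0<e/B = subst (_< 1/ B * e) (*-zeroʳ (1/ B)) (*-monoʳ-<-pos (1/ B) {{1/pos⇒pos B}} 0<e)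
    small : ∀ {n} → ∣ x n - x N ∣ < 1ℚ × ∣ z n ∣ < 1/ B * e → ∣ x n * z n ∣ < e
    small {n} (p , q) = begin-strict
      ∣ x n * z n ∣       ≡⟨ ∣p*q∣≡∣p∣*∣q∣ (x n) (z n) ⟩
      ∣ x n ∣ * ∣ z n ∣   ≤⟨ *-monoʳ-≤-nonNeg ∣ z n ∣ {{∣-∣-nonNeg (z n)}} ∣xn∣≤B ⟩
      B * ∣ z n ∣         <⟨ *-monoʳ-<-pos B q ⟩
      B * (1/ B * e)      ≡⟨ *-assoc B (1/ B) e ⟨
      B * 1/ B * e        ≡⟨ cong (_* e) (*-inverseʳ B) ⟩
      1ℚ * e              ≡⟨ *-identityˡ e ⟩
      e                   ∎
      where
      open ≤-Reasoning
      ∣xn∣≤B : ∣ x n ∣ ≤ B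
      ∣xn∣≤B = begin
        ∣ x n ∣                   ≡⟨ cong ∣_∣ (solve 2 (λ a b → a := a :- b :+ b) refl (x n) (x N)) ⟩
        ∣ x n - x N + x N ∣       ≤⟨ ∣p+q∣≤∣p∣+∣q∣ (x n - x N) (x N) ⟩
        ∣ x n - x N ∣ + ∣ x N ∣   ≤⟨ +-monoˡ-≤ ∣ x N ∣ (<⇒≤ p) ⟩
        B                         ∎

  -- Real operations act index by index, so the ring laws of ℝ and ℂ follow from identities in ℚ at
  -- each index.
  pointwise : ∀ {x y} → (∀ n → seq x n ≡ seq y n) → x ≈ᴿ y
  pointwise {x} {y} x≡y = null-zero λ n →
    trans (cong (_- seq y n) (x≡y n)) (+-inverseʳ (seq y n))

  ≈ᴿ-sym : ∀ {x y} → x ≈ᴿ y → y ≈ᴿ x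
  ≈ᴿ-sym {x} {y} x≈y = null-resp
    (λ n → solve 2 (λ a b → :- (a :- b) := b :- a) refl (seq x n) (seq y n)) (null-neg x≈y)

  ≈ᴿ-trans : ∀ {x y z} → x ≈ᴿ y → y ≈ᴿ z → x ≈ᴿ z
  ≈ᴿ-trans {x} {y} {z} x≈y y≈z = null-resp
    (λ n → solve 3 (λ a b c → a :- b :+ (b :- c) := a :- c) refl (seq x n) (seq y n) (seq z n))
    (null-+ x≈y y≈z)

  +ᴿ-cong : ∀ {x x′ y y′} → x ≈ᴿ x′ → y ≈ᴿ y′ → x +ᴿ y ≈ᴿ x′ +ᴿ y′
  +ᴿ-cong {x} {x′} {y} {y′} x≈x′ y≈y′ = null-resp
    (λ n → solve 4 (λ a b c d → a :- b :+ (c :- d) := a :+ c :- (b :+ d)) refl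
      (seq x n) (seq x′ n) (seq y n) (seq y′ n))
    (null-+ x≈x′ y≈y′)

  -ᴿ-cong : ∀ {x x′} → x ≈ᴿ x′ → -ᴿ x ≈ᴿ -ᴿ x′
  -ᴿ-cong {x} {x′} x≈x′ = null-resp
    (λ n → solve 2 (λ a b → :- (a :- b) := :- a :- :- b) refl (seq x n) (seq x′ n))
    (null-neg x≈x′)

  *ᴿ-cong : ∀ {x x′ y y′} → x ≈ᴿ x′ → y ≈ᴿ y′ → x *ᴿ y ≈ᴿ x′ *ᴿ y′
  *ᴿ-cong {x} {x′} {y} {y′} x≈x′ y≈y′ = null-resp
    (λ n → solve 4 (λ a b c d → a :* (c :- d) :+ d :* (a :- b) := a :* c :- b :* d) refl
      (seq x n) (seq x′ n) (seq y n) (seq y′ n))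
    (null-+ (null-* {seq x} {λ n → seq y n - seq y′ n} (cauchy x) y≈y′)
            (null-* {seq y′} {λ n → seq x n - seq x′ n} (cauchy y′) x≈x′))

  -- Complex numbers as a commutative ring

  open RawRing ℂ-rawRing public using () renaming
    (_≈_ to _≈ᶜ_; _+_ to _+ᶜ_; _*_ to _*ᶜ_; 0# to 0ᶜ; 1# to 1ᶜ)

  pointwiseᶜ : ∀ {z w} → (∀ n → seq (re z) n ≡ seq (re w) n) →
               (∀ n → seq (im z) n ≡ seq (im w) n) → z ≈ᶜ w
  pointwiseᶜ {z} {w} p q = pointwise {re z} {re w} p , pointwise {im z} {im w} q

  ℂ-commutativeRing : CommutativeRing _ _
  ℂ-commutativeRing = record
    { RawRing ℂ-rawRing
    ; isCommutativeRing = record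
      { isRing = record
        { +-isAbelianGroup = record
          { isGroup = record
            { isMonoid = record
              { isSemigroup = record
                { isMagma = record
                  { isEquivalence = record
                    { refl  = λ {z} → pointwiseᶜ {z} {z} (λ _ → refl) (λ _ → refl)
                    ; sym   = λ {z} {w} (p , q) → ≈ᴿ-sym {re z} {re w} p , ≈ᴿ-sym {im z} {im w} q
                    ; trans = λ {z} {w} {v} (p , q) (p′ , q′) →
                        ≈ᴿ-trans {re z} {re w} {re v} p p′ , ≈ᴿ-trans {im z} {im w} {im v} q q′
                    }
                  ; ∙-cong = λ {z} {z′} {w} {w′} (p , q) (p′ , q′) →
                      +ᴿ-cong {re z} {re z′} {re w} {re w′} p p′ ,
                      +ᴿ-cong {im z} {im z′} {im w} {im w′} q q′
                  }
                ; assoc = λ z w v → pointwiseᶜ {z +ᶜ w +ᶜ v} {z +ᶜ (w +ᶜ v)}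
                    (λ n → ℚ.+-assoc (seq (re z) n) _ _) (λ n → ℚ.+-assoc (seq (im z) n) _ _)
                }
              ; identity =
                  (λ z → pointwiseᶜ {0ᶜ +ᶜ z} {z} (λ n → ℚ.+-identityˡ _) (λ n → ℚ.+-identityˡ _)) ,
                  (λ z → pointwiseᶜ {z +ᶜ 0ᶜ} {z} (λ n → ℚ.+-identityʳ _) (λ n → ℚ.+-identityʳ _))
              }
            ; inverse =
                (λ z → pointwiseᶜ {negᶜ z +ᶜ z} {0ᶜ}
                  (λ n → ℚ.+-inverseˡ (seq (re z) n)) (λ n → ℚ.+-inverseˡ (seq (im z) n))) ,
                (λ z → pointwiseᶜ {z +ᶜ negᶜ z} {0ᶜ}
                  (λ n → ℚ.+-inverseʳ (seq (re z) n)) (λ n → ℚ.+-inverseʳ (seq (im z) n)))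
            ; ⁻¹-cong = λ {z} {w} (p , q) → -ᴿ-cong {re z} {re w} p , -ᴿ-cong {im z} {im w} q
            }
          ; comm = λ z w → pointwiseᶜ {z +ᶜ w} {w +ᶜ z}
              (λ n → ℚ.+-comm (seq (re z) n) _) (λ n → ℚ.+-comm (seq (im z) n) _)
          }
        ; *-cong = λ {z} {z′} {w} {w′} (p , q) (p′ , q′) →
            +ᴿ-cong {re z *ᴿ re w} {re z′ *ᴿ re w′} { -ᴿ (im z *ᴿ im w)} { -ᴿ (im z′ *ᴿ im w′)}
              (*ᴿ-cong {re z} {re z′} {re w} {re w′} p p′)
              (-ᴿ-cong {im z *ᴿ im w} {im z′ *ᴿ im w′}
                (*ᴿ-cong {im z} {im z′} {im w} {im w′} q q′)) ,
            +ᴿ-cong {re z *ᴿ im w} {re z′ *ᴿ im w′} {im z *ᴿ re w} {im z′ *ᴿ re w′}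
              (*ᴿ-cong {re z} {re z′} {im w} {im w′} p q′)
              (*ᴿ-cong {im z} {im z′} {re w} {re w′} q p′)
        ; *-assoc = λ z w v → pointwiseᶜ {z *ᶜ w *ᶜ v} {z *ᶜ (w *ᶜ v)}
            (λ n → solve 6 (λ a b c d e f →
                (a :* c :- b :* d) :* e :- (a :* d :+ b :* c) :* f :=
                a :* (c :* e :- d :* f) :- b :* (c :* f :+ d :* e)) refl
              (seq (re z) n) (seq (im z) n) (seq (re w) n) (seq (im w) n) (seq (re v) n) (seq (im v) n))
            (λ n → solve 6 (λ a b c d e f →
                (a :* c :- b :* d) :* f :+ (a :* d :+ b :* c) :* e :=
                a :* (c :* f :+ d :* e) :+ b :* (c :* e :- d :* f)) refl
              (seq (re z) n) (seq (im z) n) (seq (re w) n) (seq (im w) n) (seq (re v) n) (seq (im v) n))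
        ; *-identity =
            (λ z → pointwiseᶜ {1ᶜ *ᶜ z} {z}
              (λ n → solve 2 (λ a b → con 1ℚ :* a :- con 0ℚ :* b := a) refl (seq (re z) n) (seq (im z) n))
              (λ n → solve 2 (λ a b → con 1ℚ :* b :+ con 0ℚ :* a := b) refl (seq (re z) n) (seq (im z) n))) ,
            (λ z → pointwiseᶜ {z *ᶜ 1ᶜ} {z}
              (λ n → solve 2 (λ a b → a :* con 1ℚ :- b :* con 0ℚ := a) refl (seq (re z) n) (seq (im z) n))
              (λ n → solve 2 (λ a b → a :* con 0ℚ :+ b :* con 1ℚ := b) refl (seq (re z) n) (seq (im z) n)))
        ; distrib =
            (λ z w v → pointwiseᶜ {z *ᶜ (w +ᶜ v)} {z *ᶜ w +ᶜ z *ᶜ v}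
              (λ n → solve 6 (λ a b c d e f →
                  a :* (c :+ e) :- b :* (d :+ f) := (a :* c :- b :* d) :+ (a :* e :- b :* f)) refl
                (seq (re z) n) (seq (im z) n) (seq (re w) n) (seq (im w) n) (seq (re v) n) (seq (im v) n))
              (λ n → solve 6 (λ a b c d e f →
                  a :* (d :+ f) :+ b :* (c :+ e) := (a :* d :+ b :* c) :+ (a :* f :+ b :* e)) refl
                (seq (re z) n) (seq (im z) n) (seq (re w) n) (seq (im w) n) (seq (re v) n) (seq (im v) n))) ,
            (λ z w v → pointwiseᶜ {(w +ᶜ v) *ᶜ z} {w *ᶜ z +ᶜ v *ᶜ z}
              (λ n → solve 6 (λ a b c d e f →
                  (c :+ e) :* a :- (d :+ f) :* b := (c :* a :- d :* b) :+ (e :* a :- f :* b)) refl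
                (seq (re z) n) (seq (im z) n) (seq (re w) n) (seq (im w) n) (seq (re v) n) (seq (im v) n))
              (λ n → solve 6 (λ a b c d e f →
                  (c :+ e) :* b :+ (d :+ f) :* a := (c :* b :+ d :* a) :+ (e :* b :+ f :* a)) refl
                (seq (re z) n) (seq (im z) n) (seq (re w) n) (seq (im w) n) (seq (re v) n) (seq (im v) n)))
        }
      ; *-comm = λ z w → pointwiseᶜ {z *ᶜ w} {w *ᶜ z}
          (λ n → solve 4 (λ a b c d → a :* c :- b :* d := c :* a :- d :* b) refl
            (seq (re z) n) (seq (im z) n) (seq (re w) n) (seq (im w) n))
          (λ n → solve 4 (λ a b c d → a :* d :+ b :* c := c :* b :+ d :* a) refl
            (seq (re z) n) (seq (im z) n) (seq (re w) n) (seq (im w) n))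
      }
    }
    where open RawRing ℂ-rawRing using () renaming (-_ to negᶜ)

  -- The support is defined by a negation, so outside it a coefficient is only not nonzero. A
  -- decidable test of one rational approximation recovers equality: either all later terms are
  -- small, or `x` stays away from 0, which is excluded.
  ≈0-stable : ∀ x → ¬ ¬ (x ≈ᴿ 0ℝ) → x ≈ᴿ 0ℝ
  -- A quarter of `e` is chosen because the negative case compares two such errors with `½ * e`.
  ≈0-stable x ¬¬x≈0 e 0<e with N , close ← cauchy x (½ * (½ * e)) (0<½* (0<½* 0<e)) =
    N , λ n n≥ → subst (_< e) (cong ∣_∣ (sym (x-0≡x n))) (small n n≥ (∣ seq x N ∣ <? ½ * e))
    where
    x-0≡x : ∀ n → seq x n - 0ℚ ≡ seq x n
    x-0≡x n = solve 1 (λ a → a :- con 0ℚ := a) refl (seq x n)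
    split : ∀ m n → ∣ seq x m ∣ ≤ ∣ seq x m - seq x n ∣ + ∣ seq x n ∣
    split m n = subst (λ z → ∣ z ∣ ≤ ∣ seq x m - seq x n ∣ + ∣ seq x n ∣)
      (solve 2 (λ a b → a :- b :+ b := a) refl (seq x m) (seq x n))
      (∣p+q∣≤∣p∣+∣q∣ (seq x m - seq x n) (seq x n))
    ½*e<e : ∀ {e} → 0ℚ < e → ½ * e < e
    ½*e<e {e} 0<e = subst₂ _<_ (ℚ.+-identityʳ _) (½*+½* e) (+-monoʳ-< (½ * e) (0<½* 0<e))
    small : ∀ n → N ℕ.≤ n → Dec (∣ seq x N ∣ < ½ * e) → ∣ seq x n ∣ < e
    small n n≥ (yes xN<) = ≤-<-trans (split n N)
      (subst (_ <_) (½*+½* e)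
        (+-mono-< (<-trans (close n N n≥ ℕ.≤-refl) (½*e<e (0<½* 0<e))) xN<))
    small n n≥ (no xN≮) = contradiction not-null ¬¬x≈0
      where
      not-null : ¬ (x ≈ᴿ 0ℝ)
      not-null x≈0 with M , h ← x≈0 (½ * (½ * e)) (0<½* (0<½* 0<e)) =
        xN≮ (≤-<-trans (split N m)
          (subst (∣ seq x N - seq x m ∣ + ∣ seq x m ∣ <_) (½*+½* (½ * e))
            (+-mono-< (close N m ℕ.≤-refl (ℕ.m≤m+n N M))
              (subst (λ z → ∣ z ∣ < ½ * (½ * e)) (x-0≡x m) (h m (ℕ.m≤n+m M N))))))
        where m = N ℕ.+ M

  -- The margin `e` between ε and ½ is spent in two halves: one on the distance from `x` to `y`, one
  -- on the slack in `_≤ᴿ_`.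
  eventually-bounded : ∀ ε x y → ε <ᴿ ½ℝ → x ≈ᴿ y → 1ℝ -ᴿ ε ≤ᴿ y → y ≤ᴿ 1ℝ +ᴿ ε →
                       Eventually (λ n → ½ < seq x n × ∣ seq x n ∣ ≤ 1ℚ + 1ℚ)
  eventually-bounded ε x y (e , 0<e , ε<½) x≈y lower upper =
    eventually-map bounds
      (eventually-× ε<½
        (eventually-× (x≈y (½ * e) (0<½* 0<e))
          (eventually-× (lower (½ * e) (0<½* 0<e)) (upper (½ * e) (0<½* 0<e)))))
    where
    open ≤-Reasoning
    bounds : ∀ {n} → seq ε n + e < ½ × ∣ seq x n - seq y n ∣ < ½ * e ×
             1ℚ + - seq ε n < seq y n + ½ * e × seq y n < 1ℚ + seq ε n + ½ * e →
             ½ < seq x n × ∣ seq x n ∣ ≤ 1ℚ + 1ℚ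
    bounds {n} (ε+e<½ , x-y , l , u) =
      ½<x , ∣-∣≤ (<⇒≤ x<2) (≤-trans (toWitness {a? = - (1ℚ + 1ℚ) ≤? ½} _) (<⇒≤ ½<x))
      where
      X = seq x n
      Y = seq y n
      E = seq ε n
      ½<x : ½ < X
      ½<x = begin-strict
        ½                                     ≡⟨⟩
        1ℚ - ½                                <⟨ +-monoʳ-< 1ℚ (neg-antimono-< ε+e<½) ⟩
        1ℚ - (E + e)                          ≡⟨ solve 2 (λ E e → con 1ℚ :- (E :+ e) := con 1ℚ :+ :- E :- e) refl E e ⟩
        1ℚ + - E - e                          <⟨ +-monoˡ-< (- e) l ⟩
        Y + ½ * e - e                         ≡⟨ cong (λ z → Y + ½ * e - z) (½*+½* e) ⟨
        Y + ½ * e - (½ * e + ½ * e)           ≡⟨ solve 3 (λ X Y e → Y :+ e :- (e :+ e) := X :- (X :- Y :+ e)) refl X Y (½ * e) ⟩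
        X - (X - Y + ½ * e)                   <⟨ +-monoʳ-< X (neg-antimono-< 0<x-y+½e) ⟩
        X - 0ℚ                                ≡⟨ solve 1 (λ a → a :- con 0ℚ := a) refl X ⟩
        X                                     ∎
        where
        0<x-y+½e : 0ℚ < X - Y + ½ * e
        0<x-y+½e = subst (_< X - Y + ½ * e) (ℚ.+-inverseˡ (½ * e))
          (+-monoˡ-< (½ * e) (<-≤-trans (neg-antimono-< x-y) (-∣p∣≤p (X - Y))))
      x<2 : X < 1ℚ + 1ℚ
      x<2 = begin-strict
        X                               ≡⟨ solve 2 (λ X Y → X := X :- Y :+ Y) refl X Y ⟩
        X - Y + Y                       ≤⟨ +-monoˡ-≤ Y (p≤∣p∣ (X - Y)) ⟩
        ∣ X - Y ∣ + Y                   <⟨ +-mono-< x-y u ⟩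
        ½ * e + (1ℚ + E + ½ * e)        ≡⟨ solve 2 (λ E e → e :+ (con 1ℚ :+ E :+ e) := con 1ℚ :+ (E :+ (e :+ e))) refl E (½ * e) ⟩
        1ℚ + (E + (½ * e + ½ * e))      ≡⟨ cong (λ z → 1ℚ + (E + z)) (½*+½* e) ⟩
        1ℚ + (E + e)                    <⟨ +-monoʳ-< 1ℚ ε+e<½ ⟩
        -- The bound is rounded up to 2, a power of two times ¼, as `no-hollow` expects.
        1ℚ + ½                          <⟨ toWitness {a? = 1ℚ + ½ <? 1ℚ + 1ℚ} _ ⟩
        1ℚ + 1ℚ                         ∎

-- The flattening of an admissible polynomial

module Flattening where
  open ≡ using (refl; sym; trans; cong; cong₂; subst)
  open import Data.Rational.Base using (_+_; _-_; -_; _*_; _<_; _≤_; ∣_∣)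
  open ℚ-Solver
  open RationalMatrices
  open RealAnalysis
  open import Algebra.Properties.CommutativeSemigroup ℕ.+-commutativeSemigroup
    using () renaming (interchange to +-interchange)
  open import Algebra.Properties.Semiring.Mult (CommutativeRing.semiring ℂ-commutativeRing)
    using () renaming (_×_ to infixr 8 _·_)
  open LinearPowers ℂ-commutativeRing
    using (monomial; flattening; flattening-multilinear; flattening-zero)
  open RawSemiringDefs (RawRing.rawSemiring ℂ-rawRing) using () renaming (sum to sumᶜ)

  -- Since re (uv) = re u re v - im u im v holds exactly at each index `m`, and not just in the
  -- limit, every complex product contributes two rational outer products.
  rank-re-seq : ∀ {A B : Set} r (u : Fin r → A → ℂ) (v : Fin r → B → ℂ) m →
                RankAtMost (r ℕ.* 2) (λ i j → seq (re (sumᶜ (λ k → u k i *ᶜ v k j))) m)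
  rank-re-seq zero    u v m = none λ _ _ → refl
  rank-re-seq (suc r) u v m =
    add (λ i → seq (re (u zero i)) m) (λ j → seq (re (v zero j)) m)
      (λ i j → solve 5 (λ a b c d s → a :* c :- b :* d :+ s := a :* c :+ (:- b :* d :+ s)) refl
        (seq (re (u zero i)) m) (seq (im (u zero i)) m) (seq (re (v zero j)) m) (seq (im (v zero j)) m)
        (seq (re (sumᶜ (λ k → u (suc k) i *ᶜ v (suc k) j))) m))
      (add (λ i → - seq (im (u zero i)) m) (λ j → seq (im (v zero j)) m) (λ _ _ → refl)
        (rank-re-seq r (u ∘ suc) (v ∘ suc) m))

  -- Exponents of the matrix entries

  unit : ∀ {n} → Fin n → Exponent n
  unit {suc n} zero    = 1 ∷ replicate n 0
  unit         (suc i) = 0 ∷ unit i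

  padded : ∀ {n} → ℕ → (e : ℕ) → Exponent n → Exponent (e ℕ.+ n)
  padded c zero    α = α
  padded c (suc e) α = c ∷ padded c e α

  -- The exponent of x₁ ⋯ x_e · x_{e+i} x_{e+j}.
  pair : ∀ {n} e → Fin n → Fin n → Exponent (e ℕ.+ n)
  pair e i j = zipWith ℕ._+_ (padded 1 e (unit i)) (padded 0 e (unit j))

  sum-unit : ∀ {n} (i : Fin n) → Vec.sum (unit i) ≡ 1
  sum-unit {suc n} zero    = cong suc (sum-zeros n)
    where
    sum-zeros : ∀ n → Vec.sum (replicate n 0) ≡ 0
    sum-zeros zero    = refl
    sum-zeros (suc n) = sum-zeros n
  sum-unit         (suc i) = sum-unit i

  sum-zipWith-+ : ∀ {n} (α β : Exponent n) →
                  Vec.sum (zipWith ℕ._+_ α β) ≡ Vec.sum α ℕ.+ Vec.sum β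
  sum-zipWith-+ []      []      = refl
  sum-zipWith-+ (a ∷ α) (b ∷ β) =
    trans (cong (a ℕ.+ b ℕ.+_) (sum-zipWith-+ α β)) (+-interchange a b (Vec.sum α) (Vec.sum β))

  sum-pair : ∀ {n} e (i j : Fin n) → Vec.sum (pair e i j) ≡ 2 ℕ.+ e
  sum-pair zero    i j = trans (sum-zipWith-+ (unit i) (unit j)) (cong₂ ℕ._+_ (sum-unit i) (sum-unit j))
  sum-pair (suc e) i j = cong suc (sum-pair e i j)

  unit≤1 : ∀ {n} (i : Fin n) → All (ℕ._≤ 1) (unit i)
  unit≤1 {suc n} zero    = ℕ.≤-refl ∷ zeros≤1 n
    where
    zeros≤1 : ∀ n → All (ℕ._≤ 1) (replicate n 0)
    zeros≤1 zero    = []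
    zeros≤1 (suc n) = ℕ.z≤n ∷ zeros≤1 n
  unit≤1         (suc i) = ℕ.z≤n ∷ unit≤1 i

  pair≤1 : ∀ {n} e {i j : Fin n} → i ≢ j → All (ℕ._≤ 1) (pair e i j)
  pair≤1 (suc e) i≢j = ℕ.≤-refl ∷ pair≤1 e i≢j
  pair≤1 zero {zero}  {zero}  i≢j = contradiction refl i≢j
  pair≤1 zero {zero}  {suc j} _   =
    ℕ.≤-refl ∷ subst (All (ℕ._≤ 1)) (sym (zipWith-identityˡ ℕ.+-identityˡ (unit j))) (unit≤1 j)
  pair≤1 zero {suc i} {zero}  _   =
    ℕ.≤-refl ∷ subst (All (ℕ._≤ 1)) (sym (zipWith-identityʳ ℕ.+-identityʳ (unit i))) (unit≤1 i)
  pair≤1 zero {suc i} {suc j} i≢j = ℕ.z≤n ∷ pair≤1 zero (i≢j ∘ cong suc)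

  ¬pair≤1 : ∀ {n} e (i : Fin n) → ¬ All (ℕ._≤ 1) (pair e i i)
  ¬pair≤1 (suc e) i       (_ ∷ α≤1) = ¬pair≤1 e i α≤1
  ¬pair≤1 zero    zero    (ℕ.s≤s () ∷ _)
  ¬pair≤1 zero    (suc i) (_ ∷ α≤1) = ¬pair≤1 zero i α≤1

  -- The matrix of an admissible polynomial

  module _ (e : ℕ) {n r : ℕ} (g : HomPoly ℝ-rawRing (e ℕ.+ n) (2 ℕ.+ e))
           (waring : HasWaringDecomposition (complexify g) r) where

    private
      d = 2 ℕ.+ e
      ℓ = proj₁ waring

      rowExponent columnExponent : Fin n → Exponent (e ℕ.+ n)
      rowExponent    i = padded 1 e (unit i)
      columnExponent j = padded 0 e (unit j)

      matrix : Fin n → Fin n → ℂ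
      matrix i j = flattening {d = d} {f = coeff ∘ ℓ} (λ k → homogeneous (ℓ k))
        {coeff (complexify g)} (proj₂ waring) (rowExponent i) (columnExponent j)

    matrix-offDiagonal : ∀ {i j} → i ≢ j → re (matrix i j) ≈ᴿ coeff g (pair e i j)
    matrix-offDiagonal {i} {j} i≢j = proj₁ (flattening-multilinear
      {d = d} {f = coeff ∘ ℓ} (λ k → homogeneous (ℓ k)) {coeff (complexify g)} (proj₂ waring)
      (rowExponent i) (columnExponent j) (pair≤1 e i≢j , sum-pair e i j))

    module _ {ε : ℝ} (ε<½ : ε <ᴿ ½ℝ) (adm : Admissible ε g) where
      open Admissible adm

      -- The exponent `pair e i i` contains a square, so it lies outside the support.
      matrix-diagonal : ∀ i → re (matrix i i) ≈ᴿ 0ℝ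
      matrix-diagonal i = proj₁ (flattening-zero
        {d = d} {f = coeff ∘ ℓ} (λ k → homogeneous (ℓ k)) {coeff (complexify g)} (proj₂ waring)
        (rowExponent i) (columnExponent i) (sum-pair e i i)
        (≈0-stable (coeff g α) ¬inSupport , pointwise {0ℝ} {0ℝ} λ _ → refl))
        where
        α = pair e i i
        ¬inSupport : ¬ InSupport g α
        ¬inSupport in-support = ¬pair≤1 e i (proj₁ (Equivalence.to (support α) in-support))

      -- The condition `i ≢ j` stands under the quantifier over `m` so that `eventually-Fin` can
      -- range over all pairs; whether it holds is decided before the threshold is chosen.
      offDiagonal-bounds : ∀ i j → Eventually (λ m → i ≢ j →
        ½ < seq (re (matrix i j)) m × ∣ seq (re (matrix i j)) m ∣ ≤ 1ℚ + 1ℚ)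
      offDiagonal-bounds i j = decide (i Fin.≟ j)
        where
        α = pair e i j
        in-support : i ≢ j → InSupport g α
        in-support i≢j = Equivalence.from (support α) (pair≤1 e i≢j , sum-pair e i j)
        decide : Dec (i ≡ j) → Eventually (λ m → i ≢ j → _ × _)
        decide (yes i≡j) = 0 , λ _ _ i≢j → contradiction i≡j i≢j
        decide (no  i≢j) = eventually-map (λ p _ → p)
          (eventually-bounded ε (re (matrix i j)) (coeff g α) ε<½ (matrix-offDiagonal i≢j)
            (lower α (in-support i≢j)) (upper α (in-support i≢j)))

      diagonal-bounds : ∀ i → Eventually (λ m → ∣ seq (re (matrix i i)) m ∣ < ¼)
      diagonal-bounds i = eventually-map
        (λ {m} → subst (λ z → ∣ z ∣ < ¼) (solve 1 (λ x → x :- con 0ℚ := x) refl (seq (re (matrix i i)) m)))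
        (matrix-diagonal i ¼ (ℚ.positive⁻¹ ¼))

      -- At one sufficiently late index all entry bounds hold, and `no-hollow` applies to the
      -- rational matrix there. The bound is stated with `s` so that it can be fixed before the
      -- number `r` of powers is known.
      few-variables : ∀ {s} → r ℕ.≤ s → n ℕ.≤ codes (s ℕ.* 2) 3
      few-variables {s} r≤s = ℕ.≮⇒≥ λ codes<n → refute codes<n
        (eventually-× (eventually-Fin diagonal-bounds)
          (eventually-Fin λ i → eventually-Fin (offDiagonal-bounds i)))
        where
        refute : codes (s ℕ.* 2) 3 ℕ.< n →
          Eventually (λ m → (∀ i → ∣ seq (re (matrix i i)) m ∣ < ¼) × (∀ i j → i ≢ j →
            ½ < seq (re (matrix i j)) m × ∣ seq (re (matrix i j)) m ∣ ≤ 1ℚ + 1ℚ)) → ⊥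
        refute codes<n (m , h) =
          no-hollow (s ℕ.* 2) (λ i j → seq (re (matrix i j)) m) codes<n
            (rank-≤ (ℕ.*-monoˡ-≤ 2 r≤s) (rank-re-seq r
              (λ k i → (d !) · monomial (coeff (ℓ k)) (rowExponent i))
              (λ k j → monomial (coeff (ℓ k)) (columnExponent j)) m))
            (proj₁ (h m ℕ.≤-refl))
            (λ i j i≢j → proj₁ (proj₂ (h m ℕ.≤-refl) i j i≢j))
            (λ i j i≢j → proj₂ (proj₂ (h m ℕ.≤-refl) i j i≢j))

-- Divergence of the minimal rank

open import Data.Nat.Base using (_≤_)
open Flattening using (few-variables)
open RationalMatrices using (codes)

corollary36 : (ε : ℝ) → 0ℝ <ᴿ ε → ε <ᴿ ½ℝ → (d : ℕ) → 2 ≤ d → TendsToInfinity (A ε d)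
corollary36 _ _ _ 1 (ℕ.s≤s ()) _
-- The threshold allows for `e` fixed variables and one free variable more than `few-variables`
-- permits for fewer than `K` powers.
corollary36 ε _ ε<½ (suc (suc e)) _ K = e ℕ.+ suc C , λ n N≤n →
  bound (ℕ.m≤n⇒∃[o]m+o≡n (ℕ.m+n≤o⇒m≤o e N≤n)) N≤n
  where
  C = codes (K ℕ.* 2) 3
  bound : ∀ {n} → ∃[ o ] e ℕ.+ o ≡ n → e ℕ.+ suc C ℕ.≤ n → ∀ a → A ε (2 ℕ.+ e) n a → K ℕ.≤ a
  bound (o , ≡.refl) N≤n a ((g , adm , waring , _) , _) = ℕ.≮⇒≥ λ a<K →
    ℕ.<⇒≱ (ℕ.+-cancelˡ-≤ e (suc C) o N≤n) (few-variables e g waring ε<½ adm (ℕ.<⇒≤ a<K))
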